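{- For all integers $q \ge d \ge c \ge 1$, $B(q,d,c) \le p(q,d,c)$, where $p(q,d,c)$ is the smallest prime number that is at least $\left\lceil \frac{q-c+1}{d-c+1}\right\rceil$. That is, every $f:\binom{[q]}{d}\to[c]$ has a $p(q,d,c)$-cover.
   Context: $\binom{[q]}{d}$ denotes the family of $d$-element subsets of $[q]=\{1,\dots,q\}$. A function $f:\binom{[q]}{d}\to[c]$ has a $t$-cover if there exist $S_1,\dots,S_t\in\binom{[q]}{d}$ (not necessarily distinct) with $S_1\cup\dots\cup S_t=[q]$ and $f(S_1)=\dots=f(S_t)$. $B(q,d,c)$ is the minimum $t$ such that every $f:\binom{[q]}{d}\to[c]$ has a $t$-cover. -}

module Defs where

open import Data.Fin.Base using (Fin)
open import Data.Fin.Subset using (Subset; ∣_∣; ⋃; ⊤)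
open import Data.List.Base using (tabulate)
open import Data.Nat.Base using (ℕ; suc; pred; _+_; _∸_; _≤_; NonZero)
open import Data.Nat.DivMod using (_/_)
open import Data.Nat.Primality using (Prime)
open import Data.Product.Base using (Σ-syntax; _×_; proj₁)
open import Function.Base using (_∘_)
open import Relation.Binary.PropositionalEquality.Core using (_≡_)

IsLeast : (ℕ → Set) → ℕ → Set
IsLeast P n = P n × (∀ m → P m → n ≤ m)

SubsetOfSize : ℕ → ℕ → Set
SubsetOfSize q d = Σ[ S ∈ Subset q ] ∣ S ∣ ≡ d

Colouring : ℕ → ℕ → ℕ → Set
Colouring q d c = SubsetOfSize q d → Fin c

HasCover : ∀ {q d c} → ℕ → Colouring q d c → Set
HasCover {q} {d} t f =
  Σ[ S ∈ (Fin t → SubsetOfSize q d) ]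
    (⋃ (tabulate (proj₁ ∘ S)) ≡ ⊤) × (∀ i j → f (S i) ≡ f (S j))

-- IsB q d c b says that B(q,d,c) is defined and equal to b.
IsB : ℕ → ℕ → ℕ → ℕ → Set
IsB q d c = IsLeast (λ t → (f : Colouring q d c) → HasCover t f)

⌈_/_⌉ : (m n : ℕ) .{{_ : NonZero n}} → ℕ
⌈ m / n ⌉ = (m + pred n) / n

-- Isp q d c p says that p = p(q,d,c). Since c ≤ d ≤ q in all uses, the
-- truncated subtractions are exact, and suc (x ∸ c) is x - c + 1.
Isp : ℕ → ℕ → ℕ → ℕ → Set
Isp q d c = IsLeast (λ p → Prime p × ⌈ suc (q ∸ c) / suc (d ∸ c) ⌉ ≤ p)

{-# OPTIONS --safe #-}

-- Passing to complements, a p-cover consists of p monochromatic sets with empty intersection,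
-- and the statement becomes a case of Sarkaria's generalised Kneser theorem.  Let G = ℤ/p.
-- A word of letters (x , i) with x ∈ [q], i ∈ G, in which every x occurs p - 1 times, gives
-- subsets A_x ⊊ G and hence sets T_i = {x : i ∈ A_x} with empty intersection.  If there is no
-- cover, the sets B_k = {i : some d-set containing the complement of T_i has colour k} are
-- proper subsets of G as well.  Ordering subwords first by |A| and then, once some B_k is
-- nonempty, by |B|, one gets an equivariant monotone labelling of the subwords by pairs
-- (sign in G, level), with at most p (q - d - 1) + c (p - 1) levels; here p prime provides
-- an equivariant choice of an element of a proper nonempty subset of G, namely its mean.
-- The hypothesis says that there are fewer levels than letters, q (p - 1), so along every full
-- flag of subwords a level, and with it a sign, is repeated.
--
-- This contradicts a ℤ/p-Tucker lemma (Dold's theorem for iterated joins of G).  The chains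
-- x₀ = v₀ and xₙ = vₙ * ν xₙ₋₁, with ν alternately r - 1 and 1 + r + … + r^(p-1) for the
-- generator r of G, satisfy ∂ xₙ = ν xₙ₋₁.  Their images under subdivision followed by the sign
-- map pair to 1 modulo p with normalised cocycles representing the classes of H*(ℤ/p), whereas
-- a normalised cochain vanishes on a flag in which a sign is repeated.
module Submission where

open import Data.Bool.Base using (Bool; true; false; if_then_else_)
import Data.Bool.Properties as Bool
open import Data.Fin.Base as Fin using (Fin; zero; suc; toℕ; quotient; remainder; combine; cast)
open import Data.Fin.Permutation using (permutation)
open import Data.Fin.Properties as Fin using (any?; all?; pigeonhole; combine-remQuot; toℕ-cast; toℕ-fromℕ<; toℕ<n; toℕ-injective)
open import Data.Fin.Subset using (Subset; inside; outside; ∣_∣; ⋃; ⊤) renaming (_∈_ to _∈ˢ_)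
open import Data.Fin.Subset.Properties using (anySubset?; ∣⊤∣≡n; ∈⊤; ⊆⊤; ⊆-antisym; p⊆p∪q; q⊆p∪q; _∈?_)
open import Data.Integer.Base using (ℤ; 0ℤ; 1ℤ; +_)
open import Data.Integer.Divisibility.Signed using (_∣_; divides; ∣⇒∣ᵤ; ∣m∣n⇒∣m+n; ∣m⇒∣-m; ∣n⇒∣m*n)
import Data.Integer.Properties as ℤ
import Data.Integer.Tactic.RingSolver as ℤ-Solver
import Data.List.Base as List
import Data.List.Properties as List
open import Data.Nat.Base as ℕ using (ℕ; zero; suc; NonZero; _<_; _≤_; s≤s; z≤n; _%_)
open import Data.Nat.Coprimality using (prime⇒coprime; coprime-Bézout)
open import Data.Nat.Divisibility using (∣1⇒≡1)
open import Data.Nat.DivMod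
open import Data.Nat.GCD using (module Bézout)
open import Data.Nat.GeneralisedArithmetic using (iterate)
open import Data.Nat.Primality using (Prime; prime⇒nonTrivial; prime⇒nonZero)
import Data.Nat.Properties as ℕ
open import Data.Nat.Tactic.RingSolver using (solve-∀)
open import Data.Product.Base using (Σ-syntax; ∃; ∃-syntax; _×_; _,_; proj₁; proj₂)
open import Data.Product.Properties using (≡-dec)
open import Data.Sum.Base using (_⊎_; inj₁; inj₂)
open import Data.Vec.Base using (Vec; []; _∷_; map; removeAt; head; lookup; tabulate; here; there)
import Data.Vec.Membership.DecPropositional as DecMembership
open import Data.Vec.Membership.Propositional using (_∈_)
import Data.Vec.Properties as Vec
open import Data.Vec.Relation.Unary.Any as Any using (here; there)
open import Data.Vec.Relation.Unary.Any.Properties using (lookup-index)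
open import Function.Base using (_∘_)
open import Relation.Binary.Bundles using (Setoid)
open import Relation.Binary.PropositionalEquality
import Relation.Binary.Reasoning.Setoid as SetoidReasoning
open import Relation.Nullary using (Dec; ¬_; contradiction; yes; no; does; map′; _×-dec_; _→-dec_; ¬?)
open import Relation.Nullary.Decidable using (dec-true; dec-false; decidable-stable)
open import Relation.Unary using (Decidable)
open import Defs

-- Integers modulo p

module Congruence (p : ℕ) where

  open import Data.Integer.Base using (-_; _+_; _-_; _*_)

  infix 4 _≈_
  record _≈_ (a b : ℤ) : Set where
    constructor congruent
    field divisible : + p ∣ a - b

  ≡⇒≈ : ∀ {a b} → a ≡ b → a ≈ b
  ≡⇒≈ {a} refl = congruent (divides 0ℤ (lemma a))
    where
    lemma : ∀ a → a - a ≡ 0ℤ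
    lemma = ℤ-Solver.solve-∀

  ≈-refl : ∀ {a} → a ≈ a
  ≈-refl = ≡⇒≈ refl

  ≈-sym : ∀ {a b} → a ≈ b → b ≈ a
  ≈-sym {a} {b} (congruent d) = congruent (subst (+ p ∣_) (lemma a b) (∣m⇒∣-m d))
    where
    lemma : ∀ a b → - (a - b) ≡ b - a
    lemma = ℤ-Solver.solve-∀

  ≈-trans : ∀ {a b c} → a ≈ b → b ≈ c → a ≈ c
  ≈-trans {a} {b} {c} (congruent d) (congruent e) =
    congruent (subst (+ p ∣_) (lemma a b c) (∣m∣n⇒∣m+n d e))
    where
    lemma : ∀ a b c → (a - b) + (b - c) ≡ a - c
    lemma = ℤ-Solver.solve-∀

  ≈-setoid : Setoid _ _
  ≈-setoid = record
    { Carrier = ℤ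
    ; _≈_ = _≈_
    ; isEquivalence = record { refl = ≈-refl ; sym = ≈-sym ; trans = ≈-trans }
    }

  -≈ : ∀ {a b c d} → a ≈ b → c ≈ d → a - c ≈ b - d
  -≈ {a} {b} {c} {d} (congruent x) (congruent y) =
    congruent (subst (+ p ∣_) (lemma a b c d) (∣m∣n⇒∣m+n x (∣m⇒∣-m y)))
    where
    lemma : ∀ a b c d → (a - b) + - (c - d) ≡ a - c - (b - d)
    lemma = ℤ-Solver.solve-∀

  +≈ : ∀ {a b c d} → a ≈ b → c ≈ d → a + c ≈ b + d
  +≈ {a} {b} {c} {d} (congruent x) (congruent y) =
    congruent (subst (+ p ∣_) (lemma a b c d) (∣m∣n⇒∣m+n x y))
    where
    lemma : ∀ a b c d → (a - b) + (c - d) ≡ a + c - (b + d)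
    lemma = ℤ-Solver.solve-∀

  -≈ʳ : ∀ x {a b} → a ≈ b → x - a ≈ x - b
  -≈ʳ x = -≈ (≈-refl {x})

  +≈ʳ : ∀ x {a b} → a ≈ b → x + a ≈ x + b
  +≈ʳ x = +≈ (≈-refl {x})

  *≈ : ∀ k {a b} → a ≈ b → k * a ≈ k * b
  *≈ k {a} {b} (congruent d) = congruent (subst (+ p ∣_) (lemma k a b) (∣n⇒∣m*n k d))
    where
    lemma : ∀ k a b → k * (a - b) ≡ k * a - k * b
    lemma = ℤ-Solver.solve-∀

  open SetoidReasoning ≈-setoid public

-- Linear functionals and cochains modulo p

module Cochains (p : ℕ) where

  open import Data.Integer.Base using (_+_; _-_; _*_)

  open Congruence p

  x-x≡0 : ∀ x → x - x ≡ 0ℤ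
  x-x≡0 = ℤ-Solver.solve-∀

  x-0≡x : ∀ x → x - 0ℤ ≡ x
  x-0≡x = ℤ-Solver.solve-∀

  -- Differences suffice as the primitive operation: 0 = F - F and F + G = F - (0 - G) yield
  -- `vanish` and `plus`.
  record IsLinear {B : Set} (L : (B → ℤ) → ℤ) : Set where
    field
      cong-≈ : ∀ {F G} → (∀ b → F b ≈ G b) → L F ≈ L G
      minus  : ∀ F G → L (λ b → F b - G b) ≈ L F - L G

    vanish : ∀ {F} → (∀ b → F b ≈ 0ℤ) → L F ≈ 0ℤ
    vanish {F} F≈0 = begin
      L F                 ≈⟨ cong-≈ (λ b → ≈-trans (F≈0 b) (≈-sym (≡⇒≈ (x-x≡0 (F b))))) ⟩
      L (λ b → F b - F b) ≈⟨ minus F F ⟩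
      L F - L F           ≡⟨ x-x≡0 (L F) ⟩
      0ℤ                  ∎

    plus : ∀ F G → L (λ b → F b + G b) ≈ L F + L G
    plus F G = begin
      L (λ b → F b + G b)        ≈⟨ cong-≈ (λ b → ≡⇒≈ (to-minus (F b) (G b))) ⟩
      L (λ b → F b - (0ℤ - G b)) ≈⟨ minus F _ ⟩
      L F - L (λ b → 0ℤ - G b)   ≈⟨ -≈ʳ (L F) (minus (λ _ → 0ℤ) G) ⟩
      L F - (L (λ _ → 0ℤ) - L G) ≈⟨ -≈ʳ (L F) (-≈ (vanish λ _ → ≈-refl) (≈-refl {L G})) ⟩
      L F - (0ℤ - L G)           ≡⟨ to-minus (L F) (L G) ⟨
      L F + L G                  ∎
      where
      to-minus : ∀ x y → x + y ≡ x - (0ℤ - y)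
      to-minus = ℤ-Solver.solve-∀

  open IsLinear public

  evaluation-linear : ∀ {B : Set} (b : B) → IsLinear (λ F → F b)
  evaluation-linear b = record { cong-≈ = λ h → h b ; minus = λ _ _ → ≈-refl }

  ∘-linear : ∀ {B C : Set} {L : (C → ℤ) → ℤ} {T : (B → ℤ) → C → ℤ} →
             IsLinear L → (∀ c → IsLinear (λ F → T F c)) → IsLinear (λ F → L (T F))
  ∘-linear l t = record
    { cong-≈ = λ h → cong-≈ l λ c → cong-≈ (t c) h
    ; minus = λ F G → ≈-trans (cong-≈ l λ c → minus (t c) F G) (minus l _ _)
    }

  precompose-linear : ∀ {B C : Set} {L : (C → ℤ) → ℤ} (h : C → B) →
                      IsLinear L → IsLinear (λ F → L (F ∘ h))
  precompose-linear h l = ∘-linear l (λ c → evaluation-linear (h c))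

  -‿linear : ∀ {B : Set} {L M : (B → ℤ) → ℤ} → IsLinear L → IsLinear M →
             IsLinear (λ F → L F - M F)
  -‿linear {L = L} {M} l m = record
    { cong-≈ = λ h → -≈ (cong-≈ l h) (cong-≈ m h)
    ; minus = λ F G → ≈-trans (-≈ (minus l F G) (minus m F G)) (≡⇒≈ (lemma (L F) (L G) (M F) (M G)))
    }
    where
    lemma : ∀ a b c d → a - b - (c - d) ≡ a - c - (b - d)
    lemma = ℤ-Solver.solve-∀

  +-linear : ∀ {B : Set} {L M : (B → ℤ) → ℤ} → IsLinear L → IsLinear M →
             IsLinear (λ F → L F + M F)
  +-linear {L = L} {M} l m = record
    { cong-≈ = λ h → +≈ (cong-≈ l h) (cong-≈ m h)
    ; minus = λ F G → ≈-trans (+≈ (minus l F G) (minus m F G)) (≡⇒≈ (lemma (L F) (L G) (M F) (M G)))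
    }
    where
    lemma : ∀ a b c d → a - b + (c - d) ≡ a + c - (b + d)
    lemma = ℤ-Solver.solve-∀

  0-linear : ∀ {B : Set} → IsLinear {B} (λ _ → 0ℤ)
  0-linear = record { cong-≈ = λ _ → ≈-refl ; minus = λ _ _ → ≈-refl }

  Cochain : Set → ℕ → Set
  Cochain A n = Vec A n → ℤ

  -- Augmented: a cochain on the empty word is a constant.
  δ : ∀ {A n} → Cochain A n → Cochain A (suc n)
  δ {n = zero}  F w       = F []
  δ {n = suc n} F (a ∷ w) = F w - δ (λ v → F (a ∷ v)) w

  δ-linear : ∀ {A n} (w : Vec A (suc n)) → IsLinear (λ F → δ F w)
  δ-linear {n = zero}  w       = evaluation-linear []
  δ-linear {n = suc n} (a ∷ w) =
    -‿linear (evaluation-linear w) (precompose-linear (a ∷_) (δ-linear w))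

  δ-vanish : ∀ {A n} (F : Cochain A n) w → (∀ i → F (removeAt w i) ≈ 0ℤ) → δ F w ≈ 0ℤ
  δ-vanish {n = zero}  F (a ∷ [])    h = h zero
  δ-vanish {n = suc n} F (a ∷ b ∷ w) h =
    -≈ (h zero) (δ-vanish (λ v → F (a ∷ v)) (b ∷ w) (h ∘ suc))

  δ-scale : ∀ {A n} k (F : Cochain A n) w → δ (λ v → k * F v) w ≡ k * δ F w
  δ-scale {n = zero}  k F w       = refl
  δ-scale {n = suc n} k F (a ∷ w) =
    trans (cong (_-_ (k * F w)) (δ-scale k (λ v → F (a ∷ v)) w)) (lemma k (F w) _)
    where
    lemma : ∀ k x y → k * x - k * y ≡ k * (x - y)
    lemma = ℤ-Solver.solve-∀

  δ-map : ∀ {A n} (r : A → A) (F : Cochain A n) w → δ (F ∘ map r) w ≡ δ F (map r w)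
  δ-map {n = zero}  r F (a ∷ []) = refl
  δ-map {n = suc n} r F (a ∷ w)  = cong (_-_ (F (map r w))) (δ-map r (λ v → F (r a ∷ v)) w)

  -- After splitting off the first letter `a`, the two copies of `δ F (b ∷ w)` cancel and the same
  -- claim for `F (a ∷ _)` is left.
  δδ≈0 : ∀ {A n} (F : Cochain A n) w → δ (δ F) w ≈ 0ℤ
  δδ≈0 {n = zero}  F (a ∷ b ∷ []) = ≡⇒≈ (x-x≡0 (F []))
  δδ≈0 {n = suc n} F (a ∷ b ∷ w)  = begin
    δ F (b ∷ w) - δ (λ v → F v - δ (λ u → F (a ∷ u)) v) (b ∷ w)
      ≈⟨ -≈ʳ (δ F (b ∷ w)) (minus (δ-linear (b ∷ w)) F (δ (λ u → F (a ∷ u)))) ⟩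
    δ F (b ∷ w) - (δ F (b ∷ w) - δ (δ (λ u → F (a ∷ u))) (b ∷ w))
      ≈⟨ -≈ʳ (δ F (b ∷ w)) (-≈ʳ (δ F (b ∷ w)) (δδ≈0 (λ u → F (a ∷ u)) (b ∷ w))) ⟩
    δ F (b ∷ w) - (δ F (b ∷ w) - 0ℤ)
      ≡⟨ lemma (δ F (b ∷ w)) ⟩
    0ℤ ∎
    where
    lemma : ∀ x → x - (x - 0ℤ) ≡ 0ℤ
    lemma = ℤ-Solver.solve-∀

  -- Orbit sums and the periodic resolution

  orbitSum : ∀ {B : Set} → (B → B) → ℕ → (B → ℤ) → B → ℤ
  orbitSum r zero    F b = 0ℤ
  orbitSum r (suc k) F b = F b + orbitSum r k F (r b)

  orbitSum-shift : ∀ {B : Set} (r : B → B) k F b →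
    orbitSum r k F (r b) - orbitSum r k F b ≡ F (iterate r b k) - F b
  orbitSum-shift r zero    F b = sym (x-x≡0 (F b))
  orbitSum-shift r (suc k) F b =
    trans (lemma₁ (F (r b)) (orbitSum r k F (r (r b))) (F b) (orbitSum r k F (r b)))
      (trans (cong (_+ (F (r b) - F b)) (orbitSum-shift r k F (r b)))
             (lemma₂ (F (iterate r (r b) k)) (F (r b)) (F b)))
    where
    lemma₁ : ∀ x y z w → (x + y) - (z + w) ≡ (y - w) + (x - z)
    lemma₁ = ℤ-Solver.solve-∀
    lemma₂ : ∀ x y z → x - y + (y - z) ≡ x - z
    lemma₂ = ℤ-Solver.solve-∀

  orbitSum-telescope : ∀ {B : Set} (r : B → B) k (F : B → ℤ) b →
    orbitSum r k (λ c → F (r c) - F c) b ≡ F (iterate r b k) - F b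
  orbitSum-telescope r zero    F b = sym (x-x≡0 (F b))
  orbitSum-telescope r (suc k) F b =
    trans (cong (_+_ (F (r b) - F b)) (orbitSum-telescope r k F (r b)))
          (lemma (F (r b)) (F b) (F (iterate r (r b) k)))
    where
    lemma : ∀ x y z → x - y + (z - x) ≡ z - y
    lemma = ℤ-Solver.solve-∀

  orbitSum-linear : ∀ {B : Set} (r : B → B) k b → IsLinear (λ F → orbitSum r k F b)
  orbitSum-linear r zero    b = 0-linear
  orbitSum-linear r (suc k) b = +-linear (evaluation-linear b) (orbitSum-linear r k (r b))

  -- The two maps of the periodic resolution of ℤ over ℤ[ℤ/p].
  ν : ∀ {B : Set} → (B → B) → ℕ → (B → ℤ) → B → ℤ
  ν r zero          F b = F (r b) - F b
  ν r (suc zero)    F b = orbitSum r p F b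
  ν r (suc (suc k)) F b = ν r k F b

  ν-linear : ∀ {B : Set} (r : B → B) k b → IsLinear (λ F → ν r k F b)
  ν-linear r zero          b = -‿linear (evaluation-linear (r b)) (evaluation-linear b)
  ν-linear r (suc zero)    b = orbitSum-linear r p b
  ν-linear r (suc (suc k)) b = ν-linear r k b

  -- In either order the product of r - 1 and 1 + r + ... + r^(p-1) telescopes to r^p - 1, which
  -- acts as zero.
  νν≈0 : ∀ {B : Set} (r : B → B) → (∀ b → iterate r b p ≡ b) →
         ∀ k F b → ν r k (ν r (suc k) F) b ≈ 0ℤ
  νν≈0 r period zero F b =
    ≡⇒≈ (trans (orbitSum-shift r p F b) (trans (cong (λ c → F c - F b) (period b)) (x-x≡0 (F b))))
  νν≈0 r period (suc zero) F b =
    ≡⇒≈ (trans (orbitSum-telescope r p F b) (trans (cong (λ c → F c - F b) (period b)) (x-x≡0 (F b))))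
  νν≈0 r period (suc (suc k)) F b = νν≈0 r period k F b

  module _ {B C : Set} (rB : B → B) (rC : C → C) (T : (B → ℤ) → C → ℤ)
           (T-linear : ∀ c → IsLinear (λ F → T F c))
           (T-equivariant : ∀ F c → T (F ∘ rB) c ≈ T F (rC c)) where

    orbitSum-commutes : ∀ k F c → T (orbitSum rB k F) c ≈ orbitSum rC k (T F) c
    orbitSum-commutes zero    F c = vanish (T-linear c) (λ _ → ≈-refl)
    orbitSum-commutes (suc k) F c = begin
      T (orbitSum rB (suc k) F) c         ≈⟨ plus (T-linear c) F _ ⟩
      T F c + T (orbitSum rB k F ∘ rB) c  ≈⟨ +≈ʳ (T F c) (T-equivariant (orbitSum rB k F) c) ⟩
      T F c + T (orbitSum rB k F) (rC c)  ≈⟨ +≈ʳ (T F c) (orbitSum-commutes k F (rC c)) ⟩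
      T F c + orbitSum rC k (T F) (rC c)  ∎

    -- `ν` acts through the group ring, so every equivariant linear map respects it. This serves
    -- both for `δ` and for `Φ`.
    ν-commutes : ∀ k F c → T (ν rB k F) c ≈ ν rC k (T F) c
    ν-commutes zero F c =
      ≈-trans (minus (T-linear c) (F ∘ rB) F) (-≈ (T-equivariant F c) ≈-refl)
    ν-commutes (suc zero)    F c = orbitSum-commutes p F c
    ν-commutes (suc (suc k)) F c = ν-commutes k F c

  δ-ν : ∀ {A n} (r : A → A) k (F : Cochain A n) w →
        δ (ν (map r) k F) w ≈ ν (map r) k (δ F) w
  δ-ν r = ν-commutes (map r) (map r) δ δ-linear (λ F w → ≡⇒≈ (δ-map r F w))

  map-period : ∀ {A : Set} (r : A → A) k → (∀ a → iterate r a k ≡ a) →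
               ∀ {n} (w : Vec A n) → iterate (map r) w k ≡ w
  map-period r k period []      = iterate-[] k
    where
    iterate-[] : ∀ k → iterate (map r) [] k ≡ []
    iterate-[] zero    = refl
    iterate-[] (suc k) = iterate-[] k
  map-period r k period (a ∷ w) =
    trans (iterate-∷ k a w) (cong₂ _∷_ (period a) (map-period r k period w))
    where
    iterate-∷ : ∀ k a w → iterate (map r) (a ∷ w) k ≡ iterate r a k ∷ iterate (map r) w k
    iterate-∷ zero    a w = refl
    iterate-∷ (suc k) a w = iterate-∷ k (r a) (map r w)

  -- Equivariant chains spanned by a word

  module Chains {V : Set} (r : V → V) (period : ∀ v → iterate r v p ≡ v) where

    -- Pairing with the chain x(v ∷ vs) = v * ν x(vs), the cone with apex v over ν x(vs).
    pair : ∀ {n} → Vec V n → Cochain V n → ℤ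
    pair []                        F = F []
    pair (v ∷ [])                  F = F (v ∷ [])
    pair {suc (suc n)} (v ∷ u ∷ vs) F = pair (u ∷ vs) (ν (map r) n (λ l → F (v ∷ l)))

    pair-linear : ∀ {n} (vs : Vec V n) → IsLinear (pair vs)
    pair-linear []       = evaluation-linear []
    pair-linear (v ∷ []) = evaluation-linear (v ∷ [])
    pair-linear {suc (suc n)} (v ∷ u ∷ vs) =
      ∘-linear (pair-linear (u ∷ vs)) (λ l → precompose-linear (v ∷_) (ν-linear (map r) n l))

    -- Dual to ∂ (v * z) = z - v * ∂ z for z = ν x, where the second term vanishes because z is a
    -- cycle.
    pair-δ : ∀ {n} v u (vs : Vec V n) F →
             pair (v ∷ u ∷ vs) (δ F) ≈ pair (u ∷ vs) (ν (map r) n F)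
    pair-δ {n} v u vs F = begin
      pair (u ∷ vs) (ν (map r) n (λ l → F l - δ Fᵥ l))
        ≈⟨ cong-≈ lin (λ l → minus (ν-linear (map r) n l) F (δ Fᵥ)) ⟩
      pair (u ∷ vs) (λ l → ν (map r) n F l - ν (map r) n (δ Fᵥ) l)
        ≈⟨ minus lin _ _ ⟩
      pair (u ∷ vs) (ν (map r) n F) - pair (u ∷ vs) (ν (map r) n (δ Fᵥ))
        ≈⟨ -≈ʳ (pair (u ∷ vs) (ν (map r) n F)) (cong-≈ lin (λ l → ≈-sym (δ-ν r n Fᵥ l))) ⟩
      pair (u ∷ vs) (ν (map r) n F) - pair (u ∷ vs) (δ (ν (map r) n Fᵥ))
        ≈⟨ -≈ʳ (pair (u ∷ vs) (ν (map r) n F)) (cycle u vs Fᵥ) ⟩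
      pair (u ∷ vs) (ν (map r) n F) - 0ℤ
        ≡⟨ x-0≡x _ ⟩
      pair (u ∷ vs) (ν (map r) n F) ∎
      where
      lin = pair-linear (u ∷ vs)
      Fᵥ = λ l → F (v ∷ l)
      -- The boundary of ν x is ν applied to ∂ x, which is itself ν of the preceding chain, so
      -- `νν≈0` applies. At the bottom, r - 1 annihilates the augmentation.
      cycle : ∀ {n} u (vs : Vec V n) G → pair (u ∷ vs) (δ (ν (map r) n G)) ≈ 0ℤ
      cycle u []       G = ≡⇒≈ (x-x≡0 (G []))
      cycle {suc n} u (t ∷ vs) G =
        ≈-trans (pair-δ u t vs (ν (map r) (suc n) G))
          (vanish (pair-linear (t ∷ vs)) (νν≈0 (map r) (map-period r p period) n G))

    module _ {K : Set} (key : V → K) (key-r : ∀ v → key (r v) ≡ key v) where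

      map-key-r : ∀ {n} (l : Vec V n) → map key (map r l) ≡ map key l
      map-key-r []      = refl
      map-key-r (v ∷ l) = cong₂ _∷_ (key-r v) (map-key-r l)

      ν-vanish : ∀ {n} k (xs : Vec K n) F → (∀ l → map key l ≡ xs → F l ≈ 0ℤ) →
                 ∀ l → map key l ≡ xs → ν (map r) k F l ≈ 0ℤ
      ν-vanish zero xs F h l eq = -≈ (h _ (trans (map-key-r l) eq)) (h l eq)
      ν-vanish (suc zero) xs F h = go p
        where
        go : ∀ k l → map key l ≡ xs → orbitSum (map r) k F l ≈ 0ℤ
        go zero    l eq = ≈-refl
        go (suc k) l eq = +≈ (h l eq) (go k (map r l) (trans (map-key-r l) eq))
      ν-vanish (suc (suc k)) xs F h = ν-vanish k xs F h

      -- The chain of `vs` is a combination of words obtained by moving each letter of `vs` within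
      -- its orbit, and `key` is constant on orbits.
      pair-vanish : ∀ {n} (vs : Vec V n) F →
                    (∀ l → map key l ≡ map key vs → F l ≈ 0ℤ) → pair vs F ≈ 0ℤ
      pair-vanish []       F h = h [] refl
      pair-vanish (v ∷ []) F h = h (v ∷ []) refl
      pair-vanish {suc (suc n)} (v ∷ u ∷ vs) F h =
        pair-vanish (u ∷ vs) _ (ν-vanish n _ _ (λ l eq → h (v ∷ l) (cong (key v ∷_) eq)))

-- Pullback along the sign map

module Pullback (p : ℕ) {V Z : Set} (rV : V → V) (rZ : Z → Z)
  (sgn : ∀ {n} → Vec V (suc n) → Z)
  (sgn-equivariant : ∀ {n} (l : Vec V (suc n)) → sgn (map rV l) ≡ rZ (sgn l)) where

  open import Data.Integer.Base using (_-_)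

  open Congruence p
  open Cochains p

  -- Pullback along the composite of barycentric subdivision with the simplicial map sgn.
  Φ : ∀ {n} → Cochain Z n → Cochain V n
  Φ {zero}  F l = F []
  Φ {suc n} F l = δ (Φ (λ w → F (sgn l ∷ w))) l

  Φ-linear : ∀ {n} (l : Vec V n) → IsLinear (λ F → Φ F l)
  Φ-linear {zero}  l = evaluation-linear []
  Φ-linear {suc n} l =
    ∘-linear (δ-linear l) (λ k → precompose-linear (sgn l ∷_) (Φ-linear k))

  Φ-equivariant : ∀ {n} (F : Cochain Z n) l → Φ (F ∘ map rZ) l ≈ Φ F (map rV l)
  Φ-equivariant {zero}  F l = ≈-refl
  Φ-equivariant {suc n} F l = begin
    δ (Φ ((λ w → F (rZ (sgn l) ∷ w)) ∘ map rZ)) l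
      ≈⟨ cong-≈ (δ-linear l) (Φ-equivariant (λ w → F (rZ (sgn l) ∷ w))) ⟩
    δ (Φ (λ w → F (rZ (sgn l) ∷ w)) ∘ map rV) l
      ≡⟨ δ-map rV (Φ (λ w → F (rZ (sgn l) ∷ w))) l ⟩
    δ (Φ (λ w → F (rZ (sgn l) ∷ w))) (map rV l)
      ≡⟨ cong (λ z → δ (Φ (λ w → F (z ∷ w))) (map rV l)) (sgn-equivariant l) ⟨
    Φ F (map rV l) ∎

  -- The face omitting the leading sign contributes `δ (Φ F)`; by induction the others contribute
  -- `δ (δ (Φ Fₛ))`, which vanishes.
  Φ-δ : ∀ {n} (F : Cochain Z n) l → Φ (δ F) l ≈ δ (Φ F) l
  Φ-δ {zero}  F l = ≈-refl
  Φ-δ {suc n} F l = begin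
    δ (Φ (λ w → F w - δ Fₛ w)) l          ≈⟨ cong-≈ lin (λ k → minus (Φ-linear k) F (δ Fₛ)) ⟩
    δ (λ k → Φ F k - Φ (δ Fₛ) k) l        ≈⟨ minus lin (Φ F) (Φ (δ Fₛ)) ⟩
    δ (Φ F) l - δ (Φ (δ Fₛ)) l            ≈⟨ -≈ʳ (δ (Φ F) l) (cong-≈ lin (Φ-δ Fₛ)) ⟩
    δ (Φ F) l - δ (δ (Φ Fₛ)) l            ≈⟨ -≈ʳ (δ (Φ F) l) (δδ≈0 (Φ Fₛ) l) ⟩
    δ (Φ F) l - 0ℤ                        ≡⟨ x-0≡x (δ (Φ F) l) ⟩
    δ (Φ F) l                             ∎
    where
    lin = δ-linear l
    Fₛ = λ w → F (sgn l ∷ w)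

  Φ-ν : ∀ {n} k (F : Cochain Z n) l → Φ (ν (map rZ) k F) l ≈ ν (map rV) k (Φ F) l
  Φ-ν = ν-commutes (map rZ) (map rV) Φ Φ-linear Φ-equivariant

-- Degenerate words and normalised cochains

data Stutter {Z : Set} : ∀ {n} → Vec Z n → Set where
  here  : ∀ {n a} {w : Vec Z n} → Stutter (a ∷ a ∷ w)
  there : ∀ {n a} {w : Vec Z n} → Stutter w → Stutter (a ∷ w)

module Normalised (p : ℕ) where

  open import Data.Integer.Base using (_-_)

  open Congruence p
  open Cochains p

  Normal : ∀ {Z n} → Cochain Z n → Set
  Normal F = ∀ w → Stutter w → F w ≈ 0ℤ

  -- The two faces that omit one of two equal neighbours cancel, and every other face still
  -- stutters.
  δ-normal : ∀ {Z n} {F : Cochain Z n} → Normal F → Normal (δ F)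
  δ-normal {n = zero} h (a ∷ []) (there ())
  δ-normal {n = suc zero} {F} h (a ∷ a ∷ []) here = ≡⇒≈ (x-x≡0 (F (a ∷ [])))
  δ-normal {n = suc (suc n)} {F} h (a ∷ a ∷ w) here = begin
    F (a ∷ w) - (F (a ∷ w) - δ (λ v → F (a ∷ a ∷ v)) w)
      ≡⟨ lemma (F (a ∷ w)) (δ (λ v → F (a ∷ a ∷ v)) w) ⟩
    δ (λ v → F (a ∷ a ∷ v)) w
      ≈⟨ vanish (δ-linear w) (λ v → h (a ∷ a ∷ v) here) ⟩
    0ℤ ∎
    where
    lemma : ∀ x y → x - (x - y) ≡ y
    lemma = ℤ-Solver.solve-∀
  δ-normal {n = suc n} {F} h (a ∷ w) (there s) =
    -≈ (h w s) (δ-normal {F = λ v → F (a ∷ v)} (λ v t → h (a ∷ v) (there t)) w s)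

  module _ {V Z : Set} (rV : V → V) (rZ : Z → Z)
    (sgn : ∀ {n} → Vec V (suc n) → Z)
    (sgn-equivariant : ∀ {n} (l : Vec V (suc n)) → sgn (map rV l) ≡ rZ (sgn l))
    (Good : ∀ {n} → Vec V n → Set)
    (Good-facet : ∀ {n} (l : Vec V (suc n)) i → Good l → Good (removeAt l i))
    (level : ∀ {n} → Vec V (suc n) → ℕ)
    (level-positive : ∀ {n} (l : Vec V (suc n)) → Good l → 0 < level l)
    (level-facet : ∀ {n} (l : Vec V (suc (suc n))) i → Good l →
       level (removeAt l i) < level l ⊎ sgn (removeAt l i) ≡ sgn l)
    where

    open Pullback p rV rZ sgn sgn-equivariant

    -- A flag longer than the number of available levels repeats a level, hence a sign.
    Φ-vanish : ∀ {n} (l : Vec V (suc n)) → Good l → level l ≤ n →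
               (F : Cochain Z (suc n)) → Normal F → Φ F l ≈ 0ℤ
    Φ-vanish {zero}  l g b F h = contradiction (ℕ.<-≤-trans (level-positive l g) b) (ℕ.<-irrefl refl)
    Φ-vanish {suc n} l g b F h = δ-vanish _ l facet
      where
      facet : ∀ i → Φ (λ w → F (sgn l ∷ w)) (removeAt l i) ≈ 0ℤ
      facet i with level-facet l i g
      ... | inj₁ less = Φ-vanish (removeAt l i) (Good-facet l i g)
                          (ℕ.≤-pred (ℕ.<-≤-trans less b)) _ (λ w s → h (sgn l ∷ w) (there s))
      ... | inj₂ same rewrite same =
        vanish (δ-linear (removeAt l i)) λ k →
          vanish (Φ-linear k) λ w → h (sgn l ∷ sgn l ∷ w) here

-- The cyclic group and elementary functions on it

module Cyclic (p : ℕ) .{{_ : NonZero p}} where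

  open import Data.Integer.Base using (_+_; _-_; _*_)

  rot : Fin p → Fin p
  rot a = suc (toℕ a) mod p

  toℕ-mod : ∀ m → toℕ (m mod p) ≡ m % p
  toℕ-mod m = toℕ-fromℕ< (m%n<n m p)

  toℕ-iterate : ∀ a k → toℕ (iterate rot a k) ≡ (toℕ a ℕ.+ k) % p
  toℕ-iterate a zero = sym (trans (cong (_% p) (ℕ.+-identityʳ (toℕ a))) (m<n⇒m%n≡m (toℕ<n a)))
  toℕ-iterate a (suc k) = begin
    toℕ (iterate rot (rot a) k)                        ≡⟨ toℕ-iterate (rot a) k ⟩
    (toℕ (rot a) ℕ.+ k) % p                            ≡⟨ cong (λ x → (x ℕ.+ k) % p) (toℕ-mod (suc (toℕ a))) ⟩
    (suc (toℕ a) % p ℕ.+ k) % p                        ≡⟨ %-distribˡ-+ (suc (toℕ a) % p) k p ⟩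
    (suc (toℕ a) % p % p ℕ.+ k % p) % p                ≡⟨ cong (λ x → (x ℕ.+ k % p) % p) (m%n%n≡m%n (suc (toℕ a)) p) ⟩
    (suc (toℕ a) % p ℕ.+ k % p) % p                    ≡⟨ %-distribˡ-+ (suc (toℕ a)) k p ⟨
    (suc (toℕ a) ℕ.+ k) % p                            ≡⟨ cong (_% p) (ℕ.+-suc (toℕ a) k) ⟨
    (toℕ a ℕ.+ suc k) % p                              ∎
    where open ≡-Reasoning

  rot-period : ∀ a → iterate rot a p ≡ a
  rot-period a = toℕ-injective (begin
    toℕ (iterate rot a p)   ≡⟨ toℕ-iterate a p ⟩
    (toℕ a ℕ.+ p) % p       ≡⟨ [m+n]%n≡m%n (toℕ a) p ⟩
    toℕ a % p               ≡⟨ m<n⇒m%n≡m (toℕ<n a) ⟩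
    toℕ a                   ∎)
    where open ≡-Reasoning

  open Congruence p
  open Cochains p
  open Normalised p

  position : Fin p → ℤ
  position a = + toℕ a

  indicator : ∀ {P : Set} → Dec P → ℤ
  indicator (yes _) = 1ℤ
  indicator (no _)  = 0ℤ

  isLast : Fin p → ℤ
  isLast a = indicator (suc (toℕ a) ℕ.≟ p)

  descent : Fin p → Fin p → ℤ
  descent a b = indicator (toℕ b ℕ.<? toℕ a)

  toℕ-rot-last : ∀ a → suc (toℕ a) ≡ p → toℕ (rot a) ≡ 0
  toℕ-rot-last a eq = trans (toℕ-mod (suc (toℕ a))) (trans (cong (_% p) eq) (n%n≡0 p))

  toℕ-rot-other : ∀ a → suc (toℕ a) ≢ p → toℕ (rot a) ≡ suc (toℕ a)
  toℕ-rot-other a neq = trans (toℕ-mod (suc (toℕ a))) (m<n⇒m%n≡m (ℕ.≤∧≢⇒< (toℕ<n a) neq))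

  position-rot : ∀ a → position (rot a) ≡ position a + 1ℤ - + p * isLast a
  position-rot a with suc (toℕ a) ℕ.≟ p
  ... | yes eq = trans (cong +_ (toℕ-rot-last a eq))
                  (trans (lemma (+ p)) (cong (λ x → + x - + p * 1ℤ) (trans (sym eq) (ℕ.+-comm 1 (toℕ a)))))
    where
    lemma : ∀ x → 0ℤ ≡ x - x * 1ℤ
    lemma = ℤ-Solver.solve-∀
  ... | no neq = trans (cong +_ (trans (toℕ-rot-other a neq) (ℕ.+-comm 1 (toℕ a))))
                  (lemma (position a + 1ℤ) (+ p))
    where
    lemma : ∀ x y → x ≡ x - y * 0ℤ
    lemma = ℤ-Solver.solve-∀

  indicator-true : ∀ {P : Set} (d : Dec P) → P → indicator d ≡ 1ℤ
  indicator-true (yes _) _ = refl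
  indicator-true (no ¬p) p = contradiction p ¬p

  indicator-false : ∀ {P : Set} (d : Dec P) → ¬ P → indicator d ≡ 0ℤ
  indicator-false (yes p) ¬p = contradiction p ¬p
  indicator-false (no _)  _  = refl

  -- Rotation changes the order of two elements only if exactly one of them wraps around to 0. In
  -- cochain terms, r - 1 applied to `descent` is the coboundary of `isLast`.
  descent-rot : ∀ a b → descent (rot a) (rot b) - descent a b ≡ isLast b - isLast a
  descent-rot a b with suc (toℕ a) ℕ.≟ p | suc (toℕ b) ℕ.≟ p
  ... | yes x | yes y =
    cong₂ _-_ (indicator-false (toℕ (rot b) ℕ.<? toℕ (rot a)) λ lt → ℕ.n≮0 (subst (toℕ (rot b) <_) (toℕ-rot-last a x) lt))
              (indicator-false (toℕ b ℕ.<? toℕ a) (ℕ.<-irrefl (ℕ.suc-injective (trans y (sym x)))))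
  ... | yes x | no y  =
    cong₂ _-_ (indicator-false (toℕ (rot b) ℕ.<? toℕ (rot a)) λ lt → ℕ.n≮0 (subst (toℕ (rot b) <_) (toℕ-rot-last a x) lt))
              (indicator-true (toℕ b ℕ.<? toℕ a) (ℕ.≤-pred (subst (suc (toℕ b) <_) (sym x) (ℕ.≤∧≢⇒< (toℕ<n b) y))))
  ... | no x  | yes y =
    cong₂ _-_ (indicator-true (toℕ (rot b) ℕ.<? toℕ (rot a)) (subst₂ _<_ (sym (toℕ-rot-last b y)) (sym (toℕ-rot-other a x)) (s≤s z≤n)))
              (indicator-false (toℕ b ℕ.<? toℕ a) λ lt → ℕ.<⇒≱ (toℕ<n a) (subst (_≤ toℕ a) y lt))
  ... | no x  | no y with toℕ b ℕ.<? toℕ a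
  ...   | yes lt = cong (_- 1ℤ) (indicator-true (toℕ (rot b) ℕ.<? toℕ (rot a))
                     (subst₂ _<_ (sym (toℕ-rot-other b y)) (sym (toℕ-rot-other a x)) (s≤s lt)))
  ...   | no ≮   = cong (_- 0ℤ) (indicator-false (toℕ (rot b) ℕ.<? toℕ (rot a))
                     λ lt → ≮ (ℕ.≤-pred (subst₂ _<_ (toℕ-rot-other b y) (toℕ-rot-other a x) lt)))

  descent-refl : ∀ a → descent a a ≡ 0ℤ
  descent-refl a = indicator-false (toℕ a ℕ.<? toℕ a) (ℕ.<-irrefl refl)

  -- Summing `position-rot` once around the orbit brings `position` back to its initial value, so p
  -- times the orbit sum equals p, and p can be cancelled in ℤ.
  isLast-orbit : ∀ a → orbitSum rot p isLast a ≡ 1ℤ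
  isLast-orbit a = ℤ.*-cancelˡ-≡ (+ p) _ _ (trans
     (lemma₁ (+ p * S) (position a))
     (trans (cong (λ x → + p * S + x - position a) (sym (cong position (rot-period a))))
     (trans (cong (λ x → + p * S + x - position a) (go p a))
       (lemma₂ (+ p) S (position a)))))
    where
    S = orbitSum rot p isLast a
    lemma₁ : ∀ x y → x ≡ x + y - y
    lemma₁ = ℤ-Solver.solve-∀
    lemma₂ : ∀ p s y → p * s + (y + p - p * s) - y ≡ p * 1ℤ
    lemma₂ = ℤ-Solver.solve-∀
    go : ∀ k a → position (iterate rot a k) ≡ position a + + k - + p * orbitSum rot k isLast a
    go zero    a = lemma (position a) (+ p)
      where
      lemma : ∀ x y → x ≡ x + 0ℤ - y * 0ℤ
      lemma = ℤ-Solver.solve-∀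
    go (suc k) a = trans (go k (rot a))
      (trans (cong (λ x → x + + k - + p * orbitSum rot k isLast (rot a)) (position-rot a))
             (lemma (position a) (+ p) (isLast a) (+ k) (orbitSum rot k isLast (rot a))))
      where
      lemma : ∀ x p l k s → x + 1ℤ - p * l + k - p * s ≡ x + (1ℤ + k) - p * (l + s)
      lemma = ℤ-Solver.solve-∀

-- Normalised cocycles that detect the chains

module Detecting (p : ℕ) .{{_ : NonZero p}} where

  open import Data.Integer.Base using (-_; _+_; _-_; _*_)

  open Congruence p
  open Cochains p
  open Normalised p
  open Cyclic p

  infixr 7 _⊙_ _⌣_

  -- `⊙` and `⌣` are the cup products from the left with a 0-cochain and with a 1-cochain; words of
  -- n + 1 letters have degree n.
  _⊙_ : ∀ {n} → (Fin p → ℤ) → Cochain (Fin p) (suc n) → Cochain (Fin p) (suc n)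
  (h ⊙ G) (a ∷ w) = h a * G (a ∷ w)

  _⌣_ : ∀ {n} → (Fin p → Fin p → ℤ) → Cochain (Fin p) (suc n) → Cochain (Fin p) (suc (suc n))
  (K ⌣ G) (a ∷ b ∷ w) = K a b * G (b ∷ w)

  ⊙-normal : ∀ {n} h {G : Cochain (Fin p) (suc n)} → Normal G → Normal (h ⊙ G)
  ⊙-normal h {G} normal (a ∷ w) s = begin
    h a * G (a ∷ w) ≈⟨ *≈ (h a) (normal (a ∷ w) s) ⟩
    h a * 0ℤ        ≡⟨ ℤ.*-zeroʳ (h a) ⟩
    0ℤ              ∎

  descent⌣-normal : ∀ {n} {G : Cochain (Fin p) (suc n)} → Normal G → Normal (descent ⌣ G)
  descent⌣-normal {G = G} normal (a ∷ a ∷ w) here =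
    ≡⇒≈ (cong (_* G (a ∷ w)) (descent-refl a))
  descent⌣-normal {G = G} normal (a ∷ b ∷ w) (there s) = begin
    descent a b * G (b ∷ w) ≈⟨ *≈ (descent a b) (normal (b ∷ w) s) ⟩
    descent a b * 0ℤ        ≡⟨ ℤ.*-zeroʳ (descent a b) ⟩
    0ℤ                      ∎

  ⊙-leibniz : ∀ {n} h (G : Cochain (Fin p) (suc n)) a b w →
    δ (h ⊙ G) (a ∷ b ∷ w) ≡ (h b - h a) * G (b ∷ w) + h a * δ G (a ∷ b ∷ w)
  ⊙-leibniz h G a b w =
    trans (cong (_-_ (h b * G (b ∷ w))) (δ-scale (h a) (λ v → G (a ∷ v)) (b ∷ w)))
          (lemma (h a) (h b) (G (b ∷ w)) (δ (λ v → G (a ∷ v)) (b ∷ w)))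
    where
    lemma : ∀ x y g d → y * g - x * d ≡ (y - x) * g + x * (g - d)
    lemma = ℤ-Solver.solve-∀

  record InvariantCocycle {n} (G : Cochain (Fin p) (suc n)) : Set where
    field
      normal    : Normal G
      cocycle   : ∀ w → δ G w ≈ 0ℤ
      invariant : ∀ w → ν (map rot) 0 G w ≈ 0ℤ

    rotate : ∀ w → G (map rot w) ≈ G w
    rotate w = begin
      G (map rot w)               ≡⟨ lemma (G (map rot w)) (G w) ⟩
      (G (map rot w) - G w) + G w ≈⟨ +≈ (invariant w) (≈-refl {G w}) ⟩
      0ℤ + G w                    ≡⟨ ℤ.+-identityˡ (G w) ⟩
      G w                         ∎
      where
      lemma : ∀ x y → x ≡ (x - y) + y
      lemma = ℤ-Solver.solve-∀

    -- The invariant factor `G` comes out of the orbit sum, and `isLast` sums to 1 over an orbit.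
    orbitSum-isLast : ∀ w → ν (map rot) 1 (isLast ⊙ G) w ≈ G w
    orbitSum-isLast (a ∷ w) = begin
      orbitSum (map rot) p (isLast ⊙ G) (a ∷ w) ≈⟨ go p a w ⟩
      G (a ∷ w) * orbitSum rot p isLast a       ≡⟨ cong (G (a ∷ w) *_) (isLast-orbit a) ⟩
      G (a ∷ w) * 1ℤ                            ≡⟨ ℤ.*-identityʳ (G (a ∷ w)) ⟩
      G (a ∷ w)                                 ∎
      where
      lemma : ∀ l g s → l * g + g * s ≡ g * (l + s)
      lemma = ℤ-Solver.solve-∀
      commute : ∀ {x y} z → x ≈ y → x * z ≈ y * z
      commute {x} {y} z x≈y =
        subst₂ _≈_ (ℤ.*-comm z x) (ℤ.*-comm z y) (*≈ z x≈y)
      go : ∀ k a w → orbitSum (map rot) k (isLast ⊙ G) (a ∷ w) ≈ G (a ∷ w) * orbitSum rot k isLast a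
      go zero    a w = ≡⇒≈ (sym (ℤ.*-zeroʳ (G (a ∷ w))))
      go (suc k) a w = begin
        x + orbitSum (map rot) k (isLast ⊙ G) (map rot (a ∷ w)) ≈⟨ +≈ʳ x (go k (rot a) (map rot w)) ⟩
        x + G (map rot (a ∷ w)) * s                             ≈⟨ +≈ʳ x (commute s (rotate (a ∷ w))) ⟩
        x + G (a ∷ w) * s                                       ≡⟨ lemma (isLast a) (G (a ∷ w)) s ⟩
        G (a ∷ w) * (isLast a + s)                              ∎
        where
        x = isLast a * G (a ∷ w)
        s = orbitSum rot k isLast (rot a)

    -- By invariance of `G`, r - 1 acts on `descent` alone and turns it into the coboundary of
    -- `isLast`. Since `G` is a cocycle, the Leibniz rule has no further term.
    ν-descent : ∀ w → ν (map rot) 0 (descent ⌣ G) w ≈ δ (isLast ⊙ G) w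
    ν-descent (a ∷ b ∷ w) = begin
      K′ * G (map rot (b ∷ w)) - K * g           ≈⟨ -≈ (*≈ K′ (rotate (b ∷ w))) (≈-refl {K * g}) ⟩
      K′ * g - K * g                             ≡⟨ lemma₁ K′ K g ⟩
      (K′ - K) * g                               ≡⟨ cong (_* g) (descent-rot a b) ⟩
      (isLast b - isLast a) * g                  ≡⟨ lemma₂ _ (isLast a) ⟩
      (isLast b - isLast a) * g + isLast a * 0ℤ  ≈⟨ +≈ʳ ((isLast b - isLast a) * g) (*≈ (isLast a) (cocycle (a ∷ b ∷ w))) ⟨
      (isLast b - isLast a) * g + isLast a * δ G (a ∷ b ∷ w) ≡⟨ ⊙-leibniz isLast G a b w ⟨
      δ (isLast ⊙ G) (a ∷ b ∷ w)                 ∎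
      where
      g = G (b ∷ w)
      K = descent a b
      K′ = descent (rot a) (rot b)
      lemma₁ : ∀ x y g → x * g - y * g ≡ (x - y) * g
      lemma₁ = ℤ-Solver.solve-∀
      lemma₂ : ∀ x y → x ≡ x + y * 0ℤ
      lemma₂ = ℤ-Solver.solve-∀

  open InvariantCocycle

  -- Raises the degree by two along the zigzag from `G` to `isLast ⊙ G`, to its coboundary, to
  -- `descent ⌣ G`, and to the coboundary of that.
  next-cocycle : ∀ {n} {G : Cochain (Fin p) (suc n)} →
                 InvariantCocycle G → InvariantCocycle (δ (descent ⌣ G))
  next-cocycle {G = G} c = record
    { normal    = δ-normal (descent⌣-normal (normal c))
    ; cocycle   = δδ≈0 (descent ⌣ G)
    ; invariant = λ w → begin
        ν (map rot) 0 (δ (descent ⌣ G)) w ≈⟨ δ-ν rot 0 (descent ⌣ G) w ⟨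
        δ (ν (map rot) 0 (descent ⌣ G)) w ≈⟨ cong-≈ (δ-linear w) (ν-descent c) ⟩
        δ (δ (isLast ⊙ G)) w              ≈⟨ δδ≈0 (isLast ⊙ G) w ⟩
        0ℤ                                ∎
    }

  positionCochain : Cochain (Fin p) 1
  positionCochain (a ∷ []) = position a

  -- The wrap-around from p - 1 to 0 makes an error of p, so this holds as a congruence modulo p and
  -- not as an equality.
  ν-position : ∀ w → ν (map rot) 0 positionCochain w ≈ 1ℤ
  ν-position (a ∷ []) = congruent (divides (- isLast a)
    (trans (cong (λ x → x - position a - 1ℤ) (position-rot a)) (lemma (position a) (+ p) (isLast a))))
    where
    lemma : ∀ x p l → x + 1ℤ - p * l - x - 1ℤ ≡ - l * p
    lemma = ℤ-Solver.solve-∀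

  first-cocycle : InvariantCocycle (δ positionCochain)
  first-cocycle = record
    { normal    = δ-normal λ { (a ∷ []) (there ()) }
    ; cocycle   = δδ≈0 positionCochain
    ; invariant = λ { w@(a ∷ b ∷ []) → begin
        ν (map rot) 0 (δ positionCochain) w ≈⟨ δ-ν rot 0 positionCochain w ⟨
        δ (ν (map rot) 0 positionCochain) w ≈⟨ cong-≈ (δ-linear w) ν-position ⟩
        0ℤ                                  ∎ }
    }

  double : ℕ → ℕ
  double zero    = zero
  double (suc m) = suc (suc (double m))

  ν-even : ∀ {B : Set} (r : B → B) m F b → ν r (double m) F b ≡ ν r 0 F b
  ν-even r zero    F b = refl
  ν-even r (suc m) F b = ν-even r m F b

  ν-odd : ∀ {B : Set} (r : B → B) m F b → ν r (suc (double m)) F b ≡ ν r 1 F b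
  ν-odd r zero    F b = refl
  ν-odd r (suc m) F b = ν-odd r m F b

  -- Has degree 2m + 1. The companion of degree 2m + 2 is `δ (isLast ⊙ oddCocycle m)`.
  oddCocycle : ∀ m → Cochain (Fin p) (suc (suc (double m)))
  oddCocycle zero    = δ positionCochain
  oddCocycle (suc m) = δ (descent ⌣ oddCocycle m)

  oddCocycle-invariant : ∀ m → InvariantCocycle (oddCocycle m)
  oddCocycle-invariant zero    = first-cocycle
  oddCocycle-invariant (suc m) = next-cocycle (oddCocycle-invariant m)

  parity : ∀ n → ∃[ m ] (n ≡ double m ⊎ n ≡ suc (double m))
  parity zero = zero , inj₁ refl
  parity (suc n) with parity n
  ... | m , inj₁ eq = m , inj₂ (cong suc eq)
  ... | m , inj₂ eq = suc m , inj₁ (cong suc eq)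

  module _ {V : Set} (rV : V → V) (period : ∀ v → iterate rV v p ≡ v)
    (sgn : ∀ {n} → Vec V (suc n) → Fin p)
    (sgn-equivariant : ∀ {n} (l : Vec V (suc n)) → sgn (map rV l) ≡ rot (sgn l)) where

    open Chains rV period
    open Pullback p rV rot sgn sgn-equivariant

    pair-Φ-linear : ∀ {n} (vs : Vec V n) → IsLinear (λ F → pair vs (Φ F))
    pair-Φ-linear vs = ∘-linear (pair-linear vs) Φ-linear

    -- One step down the zigzag: `Φ` commutes with `δ` and `ν`, and `pair` trades `δ` for `ν` on the
    -- chain with one letter less.
    pair-Φ-δ : ∀ {n} v u (vs : Vec V n) F G → (∀ w → ν (map rot) n F w ≈ G w) →
               pair (v ∷ u ∷ vs) (Φ (δ F)) ≈ pair (u ∷ vs) (Φ G)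
    pair-Φ-δ {n} v u vs F G eq = begin
      pair (v ∷ u ∷ vs) (Φ (δ F))           ≈⟨ cong-≈ (pair-linear (v ∷ u ∷ vs)) (Φ-δ F) ⟩
      pair (v ∷ u ∷ vs) (δ (Φ F))           ≈⟨ pair-δ v u vs (Φ F) ⟩
      pair (u ∷ vs) (ν (map rV) n (Φ F))    ≈⟨ cong-≈ (pair-linear (u ∷ vs)) (Φ-ν n F) ⟨
      pair (u ∷ vs) (Φ (ν (map rot) n F))   ≈⟨ cong-≈ (pair-Φ-linear (u ∷ vs)) eq ⟩
      pair (u ∷ vs) (Φ G)                   ∎

    mutual
      -- The descent alternates between r - 1 (`ν-descent`) and the full orbit sum
      -- (`orbitSum-isLast`) and ends, through `ν-position`, at the constant 1 on a single letter.
      pair-odd : ∀ m (vs : Vec V (suc (suc (double m)))) → pair vs (Φ (oddCocycle m)) ≈ 1ℤ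
      pair-odd zero    (v ∷ u ∷ []) = pair-Φ-δ v u [] positionCochain (λ _ → 1ℤ) ν-position
      pair-odd (suc m) (v ∷ u ∷ vs) =
        ≈-trans (pair-Φ-δ v u vs (descent ⌣ oddCocycle m) (δ (isLast ⊙ oddCocycle m))
                  λ w → ≈-trans (≡⇒≈ (ν-even (map rot) m _ w)) (ν-descent (oddCocycle-invariant m) w))
                (pair-even m (u ∷ vs))

      pair-even : ∀ m (vs : Vec V (suc (suc (suc (double m))))) →
                  pair vs (Φ (δ (isLast ⊙ oddCocycle m))) ≈ 1ℤ
      pair-even m (v ∷ u ∷ vs) =
        ≈-trans (pair-Φ-δ v u vs (isLast ⊙ oddCocycle m) (oddCocycle m)
                  λ w → ≈-trans (≡⇒≈ (ν-odd (map rot) m _ w)) (orbitSum-isLast (oddCocycle-invariant m) w))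
                (pair-odd m (u ∷ vs))

    detecting : ∀ n → ∃[ F ] Normal F × (∀ (vs : Vec V (suc (suc n))) → pair vs (Φ F) ≈ 1ℤ)
    detecting n with parity n
    ... | m , inj₁ refl = oddCocycle m , normal (oddCocycle-invariant m) , pair-odd m
    ... | m , inj₂ refl = δ (isLast ⊙ oddCocycle m)
                        , δ-normal (⊙-normal isLast (normal (oddCocycle-invariant m)))
                        , pair-even m

-- The Tucker lemma for ℤ/p

open import Data.Nat.Base using (_+_; _*_; _∸_; pred; z<s; nonTrivial⇒n>1)
open import Data.Nat.Properties
open import Algebra.Properties.Semiring.Sum +-*-semiring using (sum; sum-cong-≗; sum-permute; ∑-distrib-+; ∑-comm; *-distribʳ-sum)

-- A detecting cochain pairs to 1 with the chain of `vs`, since `sgn` is equivariant. It also pairs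
-- to 0: the chain is supported on words with the keys of `vs`, which are good and have a level
-- below their length, so `Φ-vanish` applies. For p ≠ 1 these values differ.
tucker : ∀ p .{{_ : NonZero p}} → p ≢ 1 →
  let open Cyclic p in
  {V K : Set} (rV : V → V) → (∀ v → iterate rV v p ≡ v) →
  (key : V → K) → (∀ v → key (rV v) ≡ key v) →
  (sgn : ∀ {n} → Vec V (suc n) → Fin p) →
  (∀ {n} (l : Vec V (suc n)) → sgn (map rV l) ≡ rot (sgn l)) →
  (Good : ∀ {n} → Vec V n → Set) →
  (∀ {n} (l : Vec V (suc n)) i → Good l → Good (removeAt l i)) →
  (level : ∀ {n} → Vec V (suc n) → ℕ) →
  (∀ {n} (l : Vec V (suc n)) → Good l → 0 < level l) →
  (∀ {n} (l : Vec V (suc (suc n))) i → Good l →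
     level (removeAt l i) < level l ⊎ sgn (removeAt l i) ≡ sgn l) →
  ∀ {n} (vs : Vec V (suc (suc n))) →
  (∀ l → map key l ≡ map key vs → Good l) →
  ¬ (∀ l → map key l ≡ map key vs → level l < suc (suc n))
tucker p p≢1 rV period key key-r sgn sgn-eq Good Good-facet level level-pos level-facet {n} vs good low =
  contradiction 1≈0 1≉0
  where
  open Congruence p using (_≈_; congruent; ≈-trans; ≈-sym)
  open Cochains p using (module Chains)
  open Chains rV period using (pair-vanish)
  open Normalised p using (Φ-vanish)
  open Detecting p using (detecting)
  1≈0 : 1ℤ ≈ 0ℤ
  1≈0 with detecting rV period sgn sgn-eq n
  ... | F , normal , pair≈1 = ≈-trans (≈-sym (pair≈1 vs))
    (pair-vanish key key-r vs _ λ l eq →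
      Φ-vanish rV (Cyclic.rot p) sgn sgn-eq Good Good-facet level level-pos level-facet
        l (good l eq) (≤-pred (low l eq)) F normal)
  1≉0 : ¬ (1ℤ ≈ 0ℤ)
  1≉0 (congruent d) = p≢1 (∣1⇒≡1 (∣⇒∣ᵤ d))

-- Finite sums and indicators

sum-mono : ∀ {n} (f g : Fin n → ℕ) → (∀ i → f i ≤ g i) → sum f ≤ sum g
sum-mono {zero}  f g h = z≤n
sum-mono {suc n} f g h = +-mono-≤ (h zero) (sum-mono (f ∘ suc) (g ∘ suc) (h ∘ suc))

sum-mono-equality : ∀ {n} (f g : Fin n → ℕ) → (∀ i → f i ≤ g i) → sum g ≤ sum f → ∀ i → f i ≡ g i
sum-mono-equality {suc n} f g h le zero = ≤-antisym (h zero)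
  (+-cancelʳ-≤ (sum (g ∘ suc)) (g zero) (f zero)
    (≤-trans le (+-monoʳ-≤ (f zero) (sum-mono (f ∘ suc) (g ∘ suc) (h ∘ suc)))))
sum-mono-equality {suc n} f g h le (suc i) =
  sum-mono-equality (f ∘ suc) (g ∘ suc) (h ∘ suc)
    (+-cancelˡ-≤ (g zero) _ _ (≤-trans le (+-monoˡ-≤ (sum (f ∘ suc)) (h zero)))) i

sum-bound : ∀ {n} (f : Fin n → ℕ) b → (∀ i → f i ≤ b) → sum f ≤ n * b
sum-bound {zero}  f b h = z≤n
sum-bound {suc n} f b h = +-mono-≤ (h zero) (sum-bound (f ∘ suc) b (h ∘ suc))

sum-positive : ∀ {n} (f : Fin n → ℕ) i → f i ≤ sum f
sum-positive f zero    = m≤m+n _ _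
sum-positive f (suc i) = ≤-trans (sum-positive (f ∘ suc) i) (m≤n+m _ _)

𝟙 : Bool → ℕ
𝟙 true  = 1
𝟙 false = 0

𝟙≤1 : ∀ b → 𝟙 b ≤ 1
𝟙≤1 true  = ≤-refl
𝟙≤1 false = z≤n

𝟙-mono : ∀ {a b} → (a ≡ true → b ≡ true) → 𝟙 a ≤ 𝟙 b
𝟙-mono {false}     h = z≤n
𝟙-mono {true}  {b} h rewrite h refl = ≤-refl

𝟙-injective : ∀ {a b} → 𝟙 a ≡ 𝟙 b → a ≡ b
𝟙-injective {true}  {true}  _ = refl
𝟙-injective {false} {false} _ = refl

-- Families of subsets of ℤ/p and their equivariant signs

module Families (p : ℕ) .{{_ : NonZero p}} (isPrime : Prime p) where

  open Cyclic p

  Family : ℕ → Set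
  Family n = Fin n → Fin p → Bool

  size : (Fin p → Bool) → ℕ
  size S = sum (𝟙 ∘ S)

  rank : ∀ {n} → Family n → ℕ
  rank A = sum (size ∘ A)

  _⊑_ : ∀ {n} → Family n → Family n → Set
  A ⊑ B = ∀ x i → A x i ≡ true → B x i ≡ true

  size-mono : ∀ {S T : Fin p → Bool} → (∀ i → S i ≡ true → T i ≡ true) → size S ≤ size T
  size-mono h = sum-mono _ _ (λ i → 𝟙-mono (h i))

  rank-mono : ∀ {n} {A B : Family n} → A ⊑ B → rank A ≤ rank B
  rank-mono h = sum-mono _ _ (λ x → size-mono (h x))

  rank-mono-equality : ∀ {n} {A B : Family n} → A ⊑ B → rank B ≤ rank A → ∀ x i → A x i ≡ B x i
  rank-mono-equality {A = A} {B} h le x i = 𝟙-injective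
    (sum-mono-equality (𝟙 ∘ A x) (𝟙 ∘ B x) (λ j → 𝟙-mono (h x j))
      (≤-reflexive (sym (sum-mono-equality (size ∘ A) (size ∘ B) (λ y → size-mono (h y)) le x))) i)

  rank-positive : ∀ {n} (A : Family n) x i → A x i ≡ true → 0 < rank A
  rank-positive A x i eq = ≤-trans (≤-reflexive (sym (cong 𝟙 eq)))
    (≤-trans (sum-positive (𝟙 ∘ A x) i) (sum-positive (size ∘ A) x))

  size-proper : ∀ (S : Fin p → Bool) i → S i ≡ false → size S < p
  size-proper S i eq = ≤∧≢⇒< le λ full →
    0≢1+n (trans (cong 𝟙 (sym eq)) (sum-mono-equality (𝟙 ∘ S) (λ _ → 1) (λ j → 𝟙≤1 (S j))
      (≤-reflexive (trans (sum-one p) (sym full))) i))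
    where
    sum-one : ∀ n → sum {n} (λ _ → 1) ≡ n
    sum-one zero    = refl
    sum-one (suc n) = cong suc (sum-one n)
    le : size S ≤ p
    le = ≤-trans (sum-mono (𝟙 ∘ S) (λ _ → 1) (λ j → 𝟙≤1 (S j))) (≤-reflexive (sum-one p))

  unrot : Fin p → Fin p
  unrot a = iterate rot a (pred p)

  rot-iterate : ∀ k a → rot (iterate rot a k) ≡ iterate rot (rot a) k
  rot-iterate zero    a = refl
  rot-iterate (suc k) a = rot-iterate k (rot a)

  unrot-rot : ∀ a → unrot (rot a) ≡ a
  unrot-rot a = trans (cong (iterate rot a) (suc-pred p)) (rot-period a)

  rot-unrot : ∀ a → rot (unrot a) ≡ a
  rot-unrot a = trans (rot-iterate (pred p) a) (unrot-rot a)

  rot-injective : ∀ {a b} → rot a ≡ rot b → a ≡ b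
  rot-injective {a} {b} eq = trans (sym (unrot-rot a)) (trans (cong unrot eq) (unrot-rot b))

  sum-rot : ∀ f → sum f ≡ sum (f ∘ rot)
  sum-rot f = sum-permute f (permutation rot unrot rot-unrot unrot-rot)

  inverse : ∀ n → .{{NonZero n}} → n < p → ∃[ u ] (u * n) % p ≡ 1 % p
  inverse n n<p with coprime-Bézout (prime⇒coprime isPrime n<p)
  -- Here `1 + y * n ≡ x * p`, so y is the negative of an inverse, and the factor `pred p` stands
  -- for -1.
  ... | Bézout.+- x y eq = y * pred p , (begin
    (y * pred p * n) % p                ≡⟨ [m+n]%n≡m%n (y * pred p * n) p ⟨
    (y * pred p * n + p) % p            ≡⟨ cong (λ k → (y * pred p * n + k) % p) (suc-pred p) ⟨
    (y * pred p * n + suc (pred p)) % p ≡⟨ cong (_% p) (lemma y (pred p) n) ⟩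
    (1 + pred p * (1 + y * n)) % p      ≡⟨ cong (λ k → (1 + pred p * k) % p) eq ⟩
    (1 + pred p * (x * p)) % p          ≡⟨ cong (λ k → (1 + k) % p) (*-assoc (pred p) x p) ⟨
    (1 + pred p * x * p) % p            ≡⟨ [m+kn]%n≡m%n 1 (pred p * x) p ⟩
    1 % p                               ∎)
    where
    open ≡-Reasoning
    lemma : ∀ y k n → y * k * n + suc k ≡ 1 + k * (1 + y * n)
    lemma = solve-∀
  ... | Bézout.-+ x y eq = y , (begin
    (y * n) % p      ≡⟨ cong (_% p) eq ⟨
    (1 + x * p) % p  ≡⟨ [m+kn]%n≡m%n 1 x p ⟩
    1 % p            ∎)
    where open ≡-Reasoning

  moment : (Fin p → Bool) → ℕ
  moment S = sum (λ i → 𝟙 (S i) * toℕ i)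

  -- The junk value 0 is taken on the empty and on the full row.
  inv : ℕ → ℕ
  inv zero = 0
  inv n@(suc _) with n <? p
  ... | yes n<p = proj₁ (inverse n n<p)
  ... | no _    = 0

  inv-correct : ∀ n → 0 < n → n < p → (inv n * n) % p ≡ 1 % p
  inv-correct n@(suc _) _ n<p with n <? p
  ... | yes lt = proj₂ (inverse n lt)
  ... | no ¬lt = contradiction n<p ¬lt

  -- The mean of the elements of S, computed modulo p.
  rowSign : (Fin p → Bool) → Fin p
  rowSign S = (inv (size S) * moment S) mod p

  rowSign-cong : ∀ {S T} → (∀ i → S i ≡ T i) → rowSign S ≡ rowSign T
  rowSign-cong h = cong₂ (λ n m → (inv n * m) mod p)
    (sum-cong-≗ (λ i → cong 𝟙 (h i))) (sum-cong-≗ (λ i → cong (λ b → 𝟙 b * toℕ i) (h i)))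

  size-rot : ∀ {S T : Fin p → Bool} → (∀ i → T (rot i) ≡ S i) → size T ≡ size S
  size-rot {S} {T} h = trans (sum-rot (𝟙 ∘ T)) (sum-cong-≗ (λ i → cong 𝟙 (h i)))

  -- `T` is `S` shifted by one: each element grows by 1, and p is subtracted from those that wrap
  -- around, which k counts.
  moment-rot : ∀ {S T : Fin p → Bool} → (∀ i → T (rot i) ≡ S i) →
               ∃[ k ] moment S + size S ≡ moment T + k * p
  moment-rot {S} {T} h = sum wraps , (begin
    moment S + size S
      ≡⟨ ∑-distrib-+ (λ i → 𝟙 (S i) * toℕ i) (𝟙 ∘ S) ⟨
    sum (λ i → 𝟙 (S i) * toℕ i + 𝟙 (S i))
      ≡⟨ sum-cong-≗ term ⟩
    sum (λ i → 𝟙 (T (rot i)) * toℕ (rot i) + wraps i * p)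
      ≡⟨ ∑-distrib-+ (λ i → 𝟙 (T (rot i)) * toℕ (rot i)) (λ i → wraps i * p) ⟩
    sum (λ i → 𝟙 (T (rot i)) * toℕ (rot i)) + sum (λ i → wraps i * p)
      ≡⟨ cong₂ _+_ (sum-rot (λ i → 𝟙 (T i) * toℕ i)) (*-distribʳ-sum p wraps) ⟨
    moment T + sum wraps * p ∎)
    where
    open ≡-Reasoning
    wraps : Fin p → ℕ
    wraps i = 𝟙 (S i) * (suc (toℕ i) / p)
    lemma₁ : ∀ a b → a * b + a ≡ a * suc b
    lemma₁ = solve-∀
    lemma₂ : ∀ a b c d → a * (b + c * d) ≡ a * b + a * c * d
    lemma₂ = solve-∀
    term : ∀ i → 𝟙 (S i) * toℕ i + 𝟙 (S i) ≡ 𝟙 (T (rot i)) * toℕ (rot i) + wraps i * p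
    term i = begin
      𝟙 (S i) * toℕ i + 𝟙 (S i)
        ≡⟨ lemma₁ (𝟙 (S i)) (toℕ i) ⟩
      𝟙 (S i) * suc (toℕ i)
        ≡⟨ cong (𝟙 (S i) *_) (m≡m%n+[m/n]*n (suc (toℕ i)) p) ⟩
      𝟙 (S i) * (suc (toℕ i) % p + suc (toℕ i) / p * p)
        ≡⟨ lemma₂ (𝟙 (S i)) (suc (toℕ i) % p) (suc (toℕ i) / p) p ⟩
      𝟙 (S i) * (suc (toℕ i) % p) + wraps i * p
        ≡⟨ cong₂ (λ b m → 𝟙 b * m + wraps i * p) (h i) (toℕ-mod (suc (toℕ i))) ⟨
      𝟙 (T (rot i)) * toℕ (rot i) + wraps i * p ∎

  -- The shift adds `size S` to the moment modulo p, hence 1 to the mean. This needs `size S`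
  -- invertible modulo p, which holds strictly between 0 and the prime p.
  rowSign-rot : ∀ {S T : Fin p → Bool} → (∀ i → T (rot i) ≡ S i) →
                0 < size S → size S < p → rowSign T ≡ rot (rowSign S)
  rowSign-rot {S} {T} h pos proper with moment-rot {S} {T} h
  ... | k , eq = toℕ-injective (begin
    toℕ (rowSign T)                           ≡⟨ toℕ-mod (inv (size T) * moment T) ⟩
    (inv (size T) * moment T) % p             ≡⟨ cong (λ n → (inv n * moment T) % p) (size-rot {S} {T} h) ⟩
    (u * moment T) % p                        ≡⟨ [m+kn]%n≡m%n (u * moment T) (u * k) p ⟨
    (u * moment T + u * k * p) % p            ≡⟨ cong (_% p) (lemma₁ u (moment T) k p) ⟩
    (u * (moment T + k * p)) % p              ≡⟨ cong (λ m → (u * m) % p) eq ⟨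
    (u * (moment S + size S)) % p             ≡⟨ cong (_% p) (lemma₂ u (moment S) (size S)) ⟩
    (u * size S + u * moment S) % p           ≡⟨ %-distribˡ-+ (u * size S) (u * moment S) p ⟩
    ((u * size S) % p + (u * moment S) % p) % p ≡⟨ cong (λ m → (m + (u * moment S) % p) % p) (inv-correct (size S) pos proper) ⟩
    (1 % p + (u * moment S) % p) % p          ≡⟨ cong (λ m → (1 % p + m) % p) (m%n%n≡m%n (u * moment S) p) ⟨
    (1 % p + (u * moment S) % p % p) % p      ≡⟨ %-distribˡ-+ 1 ((u * moment S) % p) p ⟨
    suc ((u * moment S) % p) % p              ≡⟨ cong (λ m → suc m % p) (toℕ-mod (u * moment S)) ⟨
    suc (toℕ (rowSign S)) % p                 ≡⟨ toℕ-mod (suc (toℕ (rowSign S))) ⟨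
    toℕ (rot (rowSign S))                     ∎)
    where
    open ≡-Reasoning
    u = inv (size S)
    lemma₁ : ∀ u m k p → u * m + u * k * p ≡ u * (m + k * p)
    lemma₁ = solve-∀
    lemma₂ : ∀ u m n → u * (m + n) ≡ u * n + u * m
    lemma₂ = solve-∀

  ifPositive : ∀ {A : Set} → ℕ → A → A → A
  ifPositive zero    a b = b
  ifPositive (suc _) a b = a

  -- The mean of the first nonempty row. The default 0 is not equivariant, whence the hypothesis
  -- `0 < rank A` in `sign-rot`.
  sign : ∀ {n} → Family n → Fin p
  sign {zero}  A = 0 mod p
  sign {suc n} A = ifPositive (size (A zero)) (rowSign (A zero)) (sign (A ∘ suc))

  sign-cong : ∀ {n} {A B : Family n} → (∀ x i → A x i ≡ B x i) → sign A ≡ sign B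
  sign-cong {zero}  h = refl
  sign-cong {suc n} {A} {B} h = trans
    (cong (λ k → ifPositive k (rowSign (A zero)) (sign (A ∘ suc))) (sum-cong-≗ (λ i → cong 𝟙 (h zero i))))
    (cong₂ (ifPositive (size (B zero))) (rowSign-cong (h zero)) (sign-cong (h ∘ suc)))

  sign-rot : ∀ {n} {A B : Family n} → (∀ x i → B x (rot i) ≡ A x i) →
             (∀ x → size (A x) < p) → 0 < rank A → sign B ≡ rot (sign A)
  sign-rot {suc n} {A} {B} h proper pos = trans
    (cong (λ k → ifPositive k (rowSign (B zero)) (sign (B ∘ suc))) (size-rot {A zero} {B zero} (h zero)))
    (go (size (A zero)) refl)
    where
    go : ∀ k → k ≡ size (A zero) →
         ifPositive k (rowSign (B zero)) (sign (B ∘ suc)) ≡ rot (ifPositive k (rowSign (A zero)) (sign (A ∘ suc)))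
    go zero    eq = sign-rot (h ∘ suc) (proper ∘ suc) (subst (λ k → 0 < k + rank (A ∘ suc)) (sym eq) pos)
    go (suc _) eq = rowSign-rot (h zero) (subst (0 <_) eq z<s) (proper zero)

-- Finite search, unions and enlargement of sets

Exhaustible : Set → Set₁
Exhaustible A = ∀ {P : A → Set} → Decidable P → Dec (∃ P)

subset-exhaustible : ∀ q d → Exhaustible (SubsetOfSize q d)
subset-exhaustible q d {P} P? =
  map′ (λ (S , e , h) → (S , e) , h) (λ ((S , e) , h) → S , e , h) (anySubset? inSize?)
  where
  inSize? : ∀ S → Dec (Σ[ e ∈ ∣ S ∣ ≡ d ] P (S , e))
  inSize? S with ∣ S ∣ ≟ d
  ... | no ne = no (ne ∘ proj₁)
  ... | yes e = map′ (e ,_) (λ (e′ , h) → subst (λ e → P (S , e)) (≡-irrelevant e′ e) h) (P? (S , e))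

dec-does : ∀ {P : Set} (P? : Dec P) → does P? ≡ true → P
dec-does (yes p) _ = p

bool-antisym : ∀ {a b} → (a ≡ true → b ≡ true) → (b ≡ true → a ≡ true) → a ≡ b
bool-antisym h k = 𝟙-injective (≤-antisym (𝟙-mono h) (𝟙-mono k))

⋃-covers : ∀ {q} t (S : Fin t → Subset q) → (∀ x → ∃[ i ] x ∈ˢ S i) → ⋃ (List.tabulate S) ≡ ⊤
⋃-covers t S h = ⊆-antisym ⊆⊤ (λ {x} _ → let i , m = h x in go t S i m)
  where
  go : ∀ t (S : Fin t → Subset _) {x} i → x ∈ˢ S i → x ∈ˢ ⋃ (List.tabulate S)
  go (suc t) S zero    m = p⊆p∪q _ m
  go (suc t) S (suc i) m = q⊆p∪q (S zero) _ (go t (S ∘ suc) i m)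

-- The second inequality says that the complement of `T` has at most d elements. Elements outside
-- `T` are taken; those in `T` are skipped unless all remaining elements are needed to reach size d.
enlarge : ∀ q d (T : Fin q → Bool) → d ≤ q → q ≤ d + sum (𝟙 ∘ T) →
          Σ[ S ∈ SubsetOfSize q d ] (∀ x → T x ≡ false → x ∈ˢ proj₁ S)
enlarge zero .0 T z≤n _ = ([] , refl) , λ ()
enlarge (suc q) d T d≤q h with T zero in eq
enlarge (suc q) zero T d≤q h | false =
  contradiction (≤-trans h (≤-trans (sum-bound (𝟙 ∘ T ∘ suc) 1 (𝟙≤1 ∘ T ∘ suc)) (≤-reflexive (*-identityʳ q)))) 1+n≰n
enlarge (suc q) (suc d) T (s≤s d≤q) (s≤s h) | false with enlarge q d (T ∘ suc) d≤q h
... | (S , e) , k = (inside ∷ S , cong suc e) , λ { zero _ → here ; (suc x) m → there (k x m) }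
enlarge (suc q) d T d≤q h | true with d ≟ suc q
... | yes refl = (⊤ , ∣⊤∣≡n (suc q)) , λ _ _ → ∈⊤
... | no ne with enlarge q d (T ∘ suc) (≤-pred (≤∧≢⇒< d≤q ne)) (≤-pred (≤-trans h (≤-reflexive (+-suc d _))))
...   | (S , e) , k = (outside ∷ S , e) , λ { zero m → contradiction (trans (sym eq) m) (λ ()) ; (suc x) m → there (k x m) }

removeAt⊆ : ∀ {A : Set} {n} (l : Vec A (suc n)) i {v} → v ∈ removeAt l i → v ∈ l
removeAt⊆ (a ∷ l)     zero    m         = there m
removeAt⊆ (a ∷ b ∷ l) (suc i) (here eq) = here eq
removeAt⊆ (a ∷ b ∷ l) (suc i) (there m) = there (removeAt⊆ (b ∷ l) i m)

-- Signs and levels from a colouring without a cover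

module Kneser (q d c p : ℕ) .{{_ : NonZero p}} (isPrime : Prime p)
  (f : Colouring q d c) (uncovered : ¬ HasCover p f) (d<q : d < q) where

  open Cyclic p
  open Families p isPrime

  Extends : (Fin q → Bool) → Fin c → Set
  Extends T col = Σ[ S ∈ SubsetOfSize q d ] (∀ x → T x ≡ false → x ∈ˢ proj₁ S) × f S ≡ col

  extends? : ∀ T col → Dec (Extends T col)
  extends? T col = subset-exhaustible q d λ S →
    all? (λ x → (T x Bool.≟ false) →-dec (x ∈? proj₁ S)) ×-dec (f S Fin.≟ col)

  -- Column i of `A` is the set T_i, and row `col` of the result is the set B_k for the colour k =
  -- `col`.
  colours : Family q → Family c
  colours A col i = does (extends? (λ x → A x i) col)

  Proper : ∀ {n} → Family n → Set
  Proper A = ∀ x → ∃[ i ] A x i ≡ false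

  proper? : ∀ {n} (A : Family n) → Dec (Proper A)
  proper? A = all? λ x → any? λ i → A x i Bool.≟ false

  size<p : ∀ {n} {A : Family n} → Proper A → ∀ x → size (A x) < p
  size<p {A = A} proper x = size-proper (A x) (proj₁ (proper x)) (proj₂ (proper x))

  -- Larger columns have smaller complements, which more d-sets contain.
  colours-mono : ∀ {A B : Family q} → A ⊑ B → colours A ⊑ colours B
  colours-mono {A} {B} h col i m with dec-does (extends? (λ x → A x i) col) m
  ... | S , sup , eq = dec-true (extends? (λ x → B x i) col)
    (S , (λ x n → sup x (Bool.¬-not λ t → contradiction (trans (sym (h x i t)) n) λ ())) , eq)

  colours-cong : ∀ {A B : Family q} {i j} → (∀ x → B x j ≡ A x i) → ∀ col → colours B col j ≡ colours A col i
  colours-cong {A} {B} {i} {j} h col = bool-antisym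
    (λ m → let S , sup , eq = dec-does (extends? (λ x → B x j) col) m in
           dec-true (extends? (λ x → A x i) col) (S , (λ x n → sup x (trans (h x) n)) , eq))
    (λ m → let S , sup , eq = dec-does (extends? (λ x → A x i) col) m in
           dec-true (extends? (λ x → B x j) col) (S , (λ x n → sup x (trans (sym (h x)) n)) , eq))

  -- A full row would provide p sets of one colour, the i-th containing the complement of column i.
  -- Every x is missing from some column, so these sets would form a cover.
  colours-proper : ∀ {A} → Proper A → Proper (colours A)
  colours-proper {A} proper col with any? (λ i → colours A col i Bool.≟ false)
  ... | yes found = found
  ... | no none = contradiction (proj₁ ∘ ext , ⋃-covers p _ covers , same) uncovered
    where
    ext : ∀ i → Extends (λ x → A x i) col
    ext i = dec-does (extends? (λ x → A x i) col) (Bool.¬-not (λ e → none (i , e)))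
    covers : ∀ x → ∃[ i ] x ∈ˢ proj₁ (proj₁ (ext i))
    covers x = let i , e = proper x in i , proj₁ (proj₂ (ext i)) x e
    same : ∀ i j → f (proj₁ (ext i)) ≡ f (proj₁ (ext j))
    same i j = trans (proj₂ (proj₂ (ext i))) (sym (proj₂ (proj₂ (ext j))))

  offset : ℕ
  offset = p * (q ∸ suc d)

  -- If no colour appears, then no column of A is large enough to be the complement of a d-set.
  rank-offset : ∀ {A} → rank (colours A) ≡ 0 → rank A ≤ offset
  rank-offset {A} none = begin
    rank A                                ≡⟨ ∑-comm (λ x i → 𝟙 (A x i)) ⟩
    sum (λ i → sum (λ x → 𝟙 (A x i)))     ≤⟨ sum-bound _ (q ∸ suc d) column ⟩
    p * (q ∸ suc d)                       ∎
    where
    open ≤-Reasoning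
    column : ∀ i → sum (λ x → 𝟙 (A x i)) ≤ q ∸ suc d
    column i with sum (λ x → 𝟙 (A x i)) ≤? q ∸ suc d
    ... | yes le = le
    ... | no ¬le = contradiction none (>⇒≢ (rank-positive (colours A) (f S) i
                     (dec-true (extends? (λ x → A x i) (f S)) (S , sup , refl))))
      where
      large : q ≤ d + sum (λ x → 𝟙 (A x i))
      large = begin
        q                            ≡⟨ m+[n∸m]≡n d<q ⟨
        suc d + (q ∸ suc d)          ≡⟨ +-suc d _ ⟨
        d + suc (q ∸ suc d)          ≤⟨ +-monoʳ-≤ d (≰⇒> ¬le) ⟩
        d + sum (λ x → 𝟙 (A x i))    ∎
      S = proj₁ (enlarge q d (λ x → A x i) (<⇒≤ d<q) large)
      sup = proj₂ (enlarge q d (λ x → A x i) (<⇒≤ d<q) large)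

  familySign : Family q → Fin p
  familySign A = ifPositive (rank (colours A)) (sign (colours A)) (sign A)

  -- By `rank-offset`, levels of families without colours are at most `offset`; the other levels
  -- start above it, so the two ranges do not overlap.
  familyLevel : Family q → ℕ
  familyLevel A = ifPositive (rank (colours A)) (offset + rank (colours A)) (rank A)

  familySign-rot : ∀ {A B} → (∀ x i → B x (rot i) ≡ A x i) → Proper A → 0 < rank A →
                   familySign B ≡ rot (familySign A)
  familySign-rot {A} {B} h proper pos = trans
    (cong (λ k → ifPositive k (sign (colours B)) (sign B)) (sum-cong-≗ λ col → size-rot (h′ col)))
    (go (rank (colours A)) refl)
    where
    h′ : ∀ col i → colours B col (rot i) ≡ colours A col i
    h′ col i = colours-cong {A} {B} (λ x → h x i) col
    go : ∀ k → k ≡ rank (colours A) →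
         ifPositive k (sign (colours B)) (sign B) ≡ rot (ifPositive k (sign (colours A)) (sign A))
    go zero    eq = sign-rot h (size<p proper) pos
    go (suc _) eq = sign-rot h′ (size<p (colours-proper proper)) (subst (0 <_) eq z<s)

  familyLevel-positive : ∀ A → 0 < rank A → 0 < familyLevel A
  familyLevel-positive A pos with rank (colours A)
  ... | zero  = pos
  ... | suc k = ≤-trans z<s (m≤n+m (suc k) offset)

  -- Each of the c colour rows is a proper subset of ℤ/p, hence has at most p - 1 elements.
  familyLevel-bound : ∀ A → Proper A → familyLevel A ≤ offset + c * pred p
  familyLevel-bound A proper with rank (colours A) in eq
  ... | zero  = ≤-trans (rank-offset eq) (m≤m+n offset _)
  ... | suc k = +-monoʳ-≤ offset (subst (_≤ c * pred p) eq
                  (sum-bound _ (pred p) (λ col → <⇒≤pred (size<p (colours-proper proper) col))))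

  -- Within one range, nested families of equal rank coincide and so have equal signs. Gaining a
  -- first colour raises the level past `offset`, and colours are never lost.
  familyLevel-mono : ∀ {A B} → A ⊑ B → familyLevel A < familyLevel B ⊎ familySign A ≡ familySign B
  familyLevel-mono {A} {B} h with rank (colours A) in eqA | rank (colours B) in eqB
  ... | zero  | suc k = inj₁ (≤-trans (s≤s (rank-offset eqA)) (m<m+n offset z<s))
  ... | suc j | zero  = contradiction (subst₂ _≤_ eqA eqB (rank-mono (colours-mono h))) λ ()
  ... | zero  | zero with rank B ≤? rank A
  ...   | yes le = inj₂ (sign-cong (rank-mono-equality h le))
  ...   | no ¬le = inj₁ (≰⇒> ¬le)
  familyLevel-mono {A} {B} h | suc j | suc k with suc k ≤? suc j
  ...   | yes le = inj₂ (sign-cong (rank-mono-equality (colours-mono h) (subst₂ _≤_ (sym eqB) (sym eqA) le)))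
  ...   | no ¬le = inj₁ (+-monoʳ-< offset (≰⇒> ¬le))

  -- Words and the families of their letters

  V : Set
  V = Fin q × Fin p

  rotV : V → V
  rotV (x , i) = x , rot i

  rotV-period : ∀ v → iterate rotV v p ≡ v
  rotV-period (x , i) = trans (go p i) (cong (x ,_) (rot-period i))
    where
    go : ∀ k i → iterate rotV (x , i) k ≡ (x , iterate rot i k)
    go zero    i = refl
    go (suc k) i = go k (rot i)

  open DecMembership (≡-dec (Fin._≟_ {q}) (Fin._≟_ {p})) using () renaming (_∈?_ to _∈ᵛ?_)

  family : ∀ {n} → Vec V n → Family q
  family l x i = does ((x , i) ∈ᵛ? l)

  family-mono : ∀ {m n} (k : Vec V m) (l : Vec V n) → (∀ {v} → v ∈ k → v ∈ l) → family k ⊑ family l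
  family-mono k l h x i m = dec-true ((x , i) ∈ᵛ? l) (h (dec-does ((x , i) ∈ᵛ? k) m))

  family-rot : ∀ {n} (l : Vec V n) x i → family (map rotV l) x (rot i) ≡ family l x i
  family-rot l x i = bool-antisym
    (λ m → dec-true ((x , i) ∈ᵛ? l) (from l (dec-does ((x , rot i) ∈ᵛ? map rotV l) m)))
    (λ m → dec-true ((x , rot i) ∈ᵛ? map rotV l) (to l (dec-does ((x , i) ∈ᵛ? l) m)))
    where
    to : ∀ {n} (l : Vec V n) → (x , i) ∈ l → (x , rot i) ∈ map rotV l
    to (v ∷ l) (here eq) = here (cong rotV eq)
    to (v ∷ l) (there m) = there (to l m)
    from : ∀ {n} (l : Vec V n) → (x , rot i) ∈ map rotV l → (x , i) ∈ l
    from ((y , j) ∷ l) (here eq) = here (cong₂ _,_ (cong proj₁ eq) (rot-injective (cong proj₂ eq)))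
    from (v ∷ l)       (there m) = there (from l m)

  family-positive : ∀ {n} (l : Vec V (suc n)) → 0 < rank (family l)
  family-positive ((x , i) ∷ l) =
    rank-positive (family ((x , i) ∷ l)) x i (dec-true ((x , i) ∈ᵛ? ((x , i) ∷ l)) (here refl))

  Good : ∀ {n} → Vec V n → Set
  Good l = Proper (family l)

  Good-facet : ∀ {n} (l : Vec V (suc n)) i → Good l → Good (removeAt l i)
  Good-facet l j proper x = let i , e = proper x in
    i , Bool.¬-not (λ t → contradiction (trans (sym (family-mono (removeAt l j) l (removeAt⊆ l j) x i t)) e) λ ())

  -- Outside the good words only equivariance matters, which the first letter provides.
  sgn : ∀ {n} → Vec V (suc n) → Fin p
  sgn l = if does (proper? (family l)) then familySign (family l) else proj₂ (head l)

  sgn-good : ∀ {n} (l : Vec V (suc n)) → Good l → sgn l ≡ familySign (family l)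
  sgn-good l g rewrite dec-true (proper? (family l)) g = refl

  sgn-bad : ∀ {n} (l : Vec V (suc n)) → ¬ Good l → sgn l ≡ proj₂ (head l)
  sgn-bad l g rewrite dec-false (proper? (family l)) g = refl

  sgn-equivariant : ∀ {n} (l : Vec V (suc n)) → sgn (map rotV l) ≡ rot (sgn l)
  sgn-equivariant l with proper? (family l)
  ... | yes g = trans (sgn-good (map rotV l) λ x → let i , e = g x in rot i , trans (family-rot l x i) e)
                  (trans (familySign-rot {family l} {family (map rotV l)} (family-rot l) g (family-positive l))
                         (cong rot (sym (sgn-good l g))))
  ... | no ¬g = trans (sgn-bad (map rotV l) λ g → ¬g λ x → let i , e = g x in
                         unrot i , trans (sym (family-rot l x (unrot i)))
                                         (trans (cong (family (map rotV l) x) (rot-unrot i)) e))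
                  (trans (head-rot l) (cong rot (sym (sgn-bad l ¬g))))
    where
    head-rot : ∀ {n} (l : Vec V (suc n)) → proj₂ (head (map rotV l)) ≡ rot (proj₂ (head l))
    head-rot (_ ∷ _) = refl

  level : ∀ {n} → Vec V (suc n) → ℕ
  level l = familyLevel (family l)

  level-facet : ∀ {n} (l : Vec V (suc (suc n))) i → Good l →
                level (removeAt l i) < level l ⊎ sgn (removeAt l i) ≡ sgn l
  level-facet l i g with familyLevel-mono (family-mono (removeAt l i) l (removeAt⊆ l i))
  ... | inj₁ lt = inj₁ lt
  ... | inj₂ same = inj₂ (trans (sgn-good (removeAt l i) (Good-facet l i g))
                           (trans same (sym (sgn-good l g))))

  -- Each x labels only p - 1 letters, too few to exhaust ℤ/p.
  blocks-good : ∀ {n} (eq : n ≡ q * pred p) (l : Vec V n) →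
                (∀ j → proj₁ (lookup l j) ≡ quotient (pred p) (cast eq j)) → Good l
  blocks-good eq l block x with any? (λ i → family l x i Bool.≟ false)
  ... | yes found = found
  ... | no none = contradiction (pigeonhole (≤-reflexive (suc-pred p)) (remainder {q} (pred p) ∘ place)) distinct
    where
    member : ∀ i → (x , i) ∈ l
    member i = dec-does ((x , i) ∈ᵛ? l) (Bool.¬-not (λ e → none (i , e)))
    place : Fin p → Fin (q * pred p)
    place i = cast eq (Any.index (member i))
    quotient-place : ∀ i → quotient {q} (pred p) (place i) ≡ x
    quotient-place i = trans (sym (block (Any.index (member i)))) (sym (cong proj₁ (lookup-index (member i))))
    distinct : ¬ (∃[ i ] ∃[ j ] i Fin.< j × remainder {q} (pred p) (place i) ≡ remainder {q} (pred p) (place j))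
    distinct (i , j , i<j , same) = Fin.<⇒≢ i<j (cong proj₂ (trans (lookup-index (member i))
      (trans (cong (lookup l) index-same) (sym (lookup-index (member j))))))
      where
      place-same : place i ≡ place j
      place-same = trans (sym (combine-remQuot {q} (pred p) (place i)))
        (trans (cong₂ combine (trans (quotient-place i) (sym (quotient-place j))) same)
               (combine-remQuot {q} (pred p) (place j)))
      index-same : Any.index (member i) ≡ Any.index (member j)
      index-same = toℕ-injective (trans (sym (toℕ-cast eq _)) (trans (cong toℕ place-same) (toℕ-cast eq _)))

  impossible : p ≢ 1 → ∀ n → suc (suc n) ≡ q * pred p → ¬ (offset + c * pred p < q * pred p)
  impossible p≢1 n eq bound =
    tucker p p≢1 rotV rotV-period proj₁ (λ _ → refl) sgn sgn-equivariant Good Good-facet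
      level (λ l _ → familyLevel-positive (family l) (family-positive l)) level-facet
      word good (λ l e → subst (level l <_) (sym eq)
                   (≤-<-trans (familyLevel-bound (family l) (good l e)) bound))
    where
    letter : Fin (suc (suc n)) → V
    -- The quotient takes each value x exactly p - 1 times. The second components are an arbitrary
    -- choice, because the chain moves them through their orbits.
    letter j = quotient (pred p) (cast eq j) , 0 mod p
    word : Vec V (suc (suc n))
    word = tabulate letter
    good : ∀ l → map proj₁ l ≡ map proj₁ word → Good l
    good l e = blocks-good eq l λ j → trans (sym (Vec.lookup-map j proj₁ l))
      (trans (cong (λ k → lookup k j) e) (trans (Vec.lookup-map j proj₁ word) (cong proj₁ (Vec.lookup∘tabulate letter j))))

-- Decidability of covers and least values

vec-exhaustible : ∀ {A} → Exhaustible A → ∀ n → Exhaustible (Vec A n)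
vec-exhaustible exh zero    P? = map′ ([] ,_) (λ { ([] , h) → h }) (P? [])
vec-exhaustible exh (suc n) P? =
  map′ (λ (a , v , h) → a ∷ v , h) (λ { (a ∷ v , h) → a , v , h })
    (exh λ a → vec-exhaustible exh n λ v → P? (a ∷ v))

-- The topological argument only refutes the absence of a cover; decidability turns this into an
-- actual cover.
hasCover? : ∀ {q d c} t (f : Colouring q d c) → Dec (HasCover t f)
hasCover? {q} {d} {c} t f =
  map′ (λ (v , h) → lookup v , h) (λ (S , h) → tabulate S , transport S h)
    (vec-exhaustible (subset-exhaustible q d) t (λ v → covers? (lookup v)))
  where
  Covers : (Fin t → SubsetOfSize q d) → Set
  Covers S = (⋃ (List.tabulate (proj₁ ∘ S)) ≡ ⊤) × (∀ i j → f (S i) ≡ f (S j))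
  covers? : ∀ S → Dec (Covers S)
  covers? S = Vec.≡-dec Bool._≟_ _ _ ×-dec all? (λ i → all? (λ j → f (S i) Fin.≟ f (S j)))
  transport : ∀ S → Covers S → Covers (lookup (tabulate S))
  transport S (cover , same) =
    trans (cong ⋃ (List.tabulate-cong (λ i → cong proj₁ (Vec.lookup∘tabulate S i)))) cover ,
    λ i j → subst₂ (λ X Y → f X ≡ f Y) (sym (Vec.lookup∘tabulate S i)) (sym (Vec.lookup∘tabulate S j)) (same i j)

-- Functions Subset q → Fin c, tabulated so that they can be searched without extensionality.
Table : ℕ → ℕ → Set
Table c zero    = Fin c
Table c (suc q) = Table c q × Table c q

table-exhaustible : ∀ c q → Exhaustible (Table c q)
table-exhaustible c zero    P? = any? P?
table-exhaustible c (suc q) P? =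
  map′ (λ (s , t , h) → (s , t) , h) (λ ((s , t) , h) → s , t , h)
    (table-exhaustible c q λ s → table-exhaustible c q λ t → P? (s , t))

readTable : ∀ {c q} → Table c q → Subset q → Fin c
readTable         t       []            = t
readTable {c}     (s , t) (inside ∷ S)  = readTable {c} s S
readTable {c}     (s , t) (outside ∷ S) = readTable {c} t S

makeTable : ∀ {c q} → (Subset q → Fin c) → Table c q
makeTable {q = zero}  g = g []
makeTable {q = suc q} g = makeTable (g ∘ (inside ∷_)) , makeTable (g ∘ (outside ∷_))

read-make : ∀ {c q} (g : Subset q → Fin c) S → readTable {c} (makeTable g) S ≡ g S
read-make g []            = refl
read-make g (inside ∷ S)  = read-make (g ∘ (inside ∷_)) S
read-make g (outside ∷ S) = read-make (g ∘ (outside ∷_)) S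

HasCover-cong : ∀ {q d c t} {f g : Colouring q d c} → (∀ S → f S ≡ g S) → HasCover t f → HasCover t g
HasCover-cong eq (S , cover , same) =
  S , cover , λ i j → trans (sym (eq (S i))) (trans (same i j) (eq (S j)))

tabulated : ∀ {q d c} → Table c q → Colouring q d c
tabulated {c = c} T (S , _) = readTable {c} T S

-- Makes B(q,d,c) computable as a least value, by a search through all tables for a counterexample.
allHaveCover? : ∀ q d c → 1 ≤ c → ∀ t → Dec ((f : Colouring q d c) → HasCover t f)
allHaveCover? q d (suc c) _ t
  with table-exhaustible (suc c) q (λ T → ¬? (hasCover? t (tabulated {q} {d} T)))
... | yes (T , none) = no λ h → none (h (tabulated T))
... | no all = yes λ f → HasCover-cong {f = tabulated (makeTable (extend f))}
                (λ (S , e) → trans (read-make (extend f) S) (extend-correct f S e))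
                (decidable-stable (hasCover? t (tabulated (makeTable (extend f)))) λ none → all (makeTable (extend f) , none))
  where
  extend : Colouring q d (suc c) → Subset q → Fin (suc c)
  extend f S with ∣ S ∣ ≟ d
  ... | yes e = f (S , e)
  -- A junk colour on subsets of other sizes, available because `1 ≤ c`.
  ... | no _  = zero
  extend-correct : ∀ f S e → extend f S ≡ f (S , e)
  extend-correct f S e with ∣ S ∣ ≟ d
  ... | yes e′ = cong (λ e → f (S , e)) (≡-irrelevant e′ e)
  ... | no ne  = contradiction e ne

least : ∀ {P : ℕ → Set} → Decidable P → ∀ n → P n → ∃[ b ] IsLeast P b × b ≤ n
least {P} P? zero    h = zero , (h , λ _ _ → z≤n) , z≤n
least {P} P? (suc n) h with P? zero
... | yes h₀ = zero , (h₀ , λ _ _ → z≤n) , z≤n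
... | no ¬h₀ with least (P? ∘ suc) n h
...   | b , (hb , minimal) , b≤n = suc b , (hb , min) , s≤s b≤n
  where
  min : ∀ m → P m → suc b ≤ m
  min zero    hm = contradiction hm ¬h₀
  min (suc m) hm = s≤s (minimal m hm)

-- Counting levels and the conclusion

⌈/⌉≤⇒≤* : ∀ m n .{{_ : NonZero n}} k → ⌈ m / n ⌉ ≤ k → m ≤ k * n
⌈/⌉≤⇒≤* m n k h = +-cancelʳ-≤ (pred n) m (k * n) (begin
  m + pred n                                     ≡⟨ m≡m%n+[m/n]*n (m + pred n) n ⟩
  (m + pred n) % n + (m + pred n) / n * n        ≤⟨ +-mono-≤ (<⇒≤pred (m%n<n (m + pred n) n)) (*-monoˡ-≤ n h) ⟩
  pred n + k * n                                 ≡⟨ +-comm (pred n) (k * n) ⟩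
  k * n + pred n                                 ∎)
  where open ≤-Reasoning

-- With d = c + a, q = d + 1 + b and p = k + 1, the claim reduces to b < k (a + 1), and the
-- hypothesis reads a + b + 2 ≤ (k + 1)(a + 1).
level-count : ∀ q d c p .{{_ : NonZero p}} → c ≤ d → d < q → suc (q ∸ c) ≤ p * suc (d ∸ c) →
              p * (q ∸ suc d) + c * pred p < q * pred p
level-count q d c (suc k) c≤d d<q h
  with a , refl ← m≤n⇒∃[o]m+o≡n c≤d
  with b , refl ← m≤n⇒∃[o]m+o≡n d<q
  = begin-strict
    suc k * (suc (c + a) + b ∸ suc (c + a)) + c * k ≡⟨ cong (λ x → suc k * x + c * k) (m+n∸m≡n (suc (c + a)) b) ⟩
    suc k * b + c * k                ≡⟨ lemma₁ k b c ⟩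
    b + (k * b + c * k)              <⟨ +-monoˡ-< (k * b + c * k) b<k*[1+a] ⟩
    k * suc a + (k * b + c * k)      ≡⟨ lemma₂ k a b c ⟩
    (suc (c + a) + b) * k            ∎
  where
  open ≤-Reasoning
  lemma₁ : ∀ k b c → suc k * b + c * k ≡ b + (k * b + c * k)
  lemma₁ = solve-∀
  lemma₂ : ∀ k a b c → k * suc a + (k * b + c * k) ≡ (suc (c + a) + b) * k
  lemma₂ = solve-∀
  lemma₃ : ∀ c a b → suc (c + a) + b ≡ c + suc (a + b)
  lemma₃ = solve-∀
  lemma₄ : ∀ a b → suc a + suc b ≡ suc (suc (a + b))
  lemma₄ = solve-∀
  b<k*[1+a] : b < k * suc a
  b<k*[1+a] = +-cancelˡ-≤ (suc a) (suc b) (k * suc a) (begin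
    suc a + suc b                    ≡⟨ lemma₄ a b ⟩
    suc (suc (a + b))                ≡⟨ cong suc (m+n∸m≡n c (suc (a + b))) ⟨
    suc (c + suc (a + b) ∸ c)        ≡⟨ cong (λ x → suc (x ∸ c)) (lemma₃ c a b) ⟨
    suc (suc (c + a) + b ∸ c)        ≤⟨ h ⟩
    suc k * suc (c + a ∸ c)          ≡⟨ cong (λ x → suc k * suc x) (m+n∸m≡n c a) ⟩
    suc k * suc a                    ∎)

hasCover-prime : ∀ q d c p → Prime p → 1 ≤ c → c ≤ d → d ≤ q → suc (q ∸ c) ≤ p * suc (d ∸ c) →
                 (f : Colouring q d c) → HasCover p f
hasCover-prime q d c p isPrime 1≤c c≤d d≤q h f with d ≟ q
-- For d = q, p copies of the whole set form a cover.
... | yes refl = (λ _ → ⊤ , ∣⊤∣≡n q) , ⋃-covers p _ (λ _ → first , ∈⊤) , λ _ _ → refl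
  where
  instance _ = prime⇒nonZero isPrime
  first : Fin p
  first = 0 mod p
... | no d≢q = decidable-stable (hasCover? p f) λ uncovered →
    Kneser.impossible q d c p isPrime f uncovered d<q (>⇒≢ 1<p) (q * pred p ∸ 2) (m+[n∸m]≡n 2≤q*[p-1])
      (level-count q d c p c≤d d<q h)
  where
  instance _ = prime⇒nonZero isPrime
  d<q : d < q
  d<q = ≤∧≢⇒< d≤q d≢q
  1<p : 1 < p
  1<p = nonTrivial⇒n>1 p {{prime⇒nonTrivial isPrime}}
  -- The Tucker lemma is stated for words of at least two letters; here q ≥ 2 because 1 ≤ c ≤ d < q.
  2≤q*[p-1] : 2 ≤ q * pred p
  2≤q*[p-1] = *-mono-≤ (≤-trans (s≤s (≤-trans 1≤c c≤d)) d<q) (<⇒≤pred 1<p)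

theorem2p6 : (q d c : ℕ) → 1 ≤ c → c ≤ d → d ≤ q →
    (p : ℕ) → Isp q d c p →
    (∃[ b ] IsB q d c b × b ≤ p) × ((f : Colouring q d c) → HasCover p f)
theorem2p6 q d c 1≤c c≤d d≤q p ((isPrime , bound) , _) =
  least (allHaveCover? q d c 1≤c) p cover , cover
  where
  cover : (f : Colouring q d c) → HasCover p f
  cover = hasCover-prime q d c p isPrime 1≤c c≤d d≤q (⌈/⌉≤⇒≤* _ _ p bound)
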